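{- Let $k\ge 1$, $n$ and $d\ge 3$ be integers, and let $\mathbb{G}_k(n,d)$ be the class of all $k$-connected graphs of order $n$ with diameter $d$. Let $G$ be a graph in $\mathbb{G}_k(n,d)$ with maximum connective eccentricity index, i.e. $\xi^{ce}(G)\ge \xi^{ce}(G')$ for all $G'\in\mathbb{G}_k(n,d)$. Then $G\cong G(n,k,d)$ if $d$ is even, and $G\in\mathcal{H}(n,k,d)$ (up to isomorphism) if $d$ is odd.
   Context: All graphs are finite, simple and connected. For a graph $G$ and $v\in V(G)$, $d_G(v)$ is the degree of $v$ and $\varepsilon_G(v)$ is the eccentricity of $v$, i.e. the maximum distance from $v$ to a vertex of $G$. The diameter of $G$ is the maximum eccentricity of its vertices. The connective eccentricity index (CEI) of $G$ is $\xi^{ce}(G)=\sum_{v\in V(G)}\frac{d_G(v)}{\varepsilon_G(v)}$. The connectivity of $G$ is the minimum size of a set $A\subseteq V(G)$ such that $G-A$ is disconnected or has exactly one vertex; $G$ is $k$-connected if its connectivity is at least $k$. $K_m$ is the complete graph on $m$ vertices. For disjoint graphs $M_1,M_2$, the join $M_1\vee M_2$ is obtained from $M_1\cup M_2$ by adding all edges $xy$ with $x\in V(M_1)$, $y\in V(M_2)$. For $t\ge 3$ disjoint graphs, $M_1\vee M_2\vee\dots\vee M_t$ denotes the sequential join $(M_1\vee M_2)\cup(M_2\vee M_3)\cup\dots\cup(M_{t-1}\vee M_t)$ (only consecutive graphs are joined). $[t]G$ denotes the sequential join of $t$ disjoint copies of $G$; inside a longer sequential join, $[t]G$ stands for $t$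 consecutive terms equal to $G$ (and is omitted when $t=0$). For even $d\ge 4$, $$G(n,k,d)=K_1\vee[(d-2)/2]K_k\vee K_{n-kd+2k-2}\vee[(d-2)/2]K_k\vee K_1 .$$ For odd $d\ge 3$, $\mathcal{H}(n,k,d)$ is the set of all graphs $$K_1\vee[(d-3)/2]K_k\vee K_{s+1}\vee K_{t+1}\vee[(d-3)/2]K_k\vee K_1,$$ where $s,t\ge k-1$ are integers with $s+t=n-kd+3k-4$. -}

module Defs where

open import Algebra.Definitions.RawMonoid using (sum)
open import Data.Fin.Base using (Fin; toℕ)
import Data.Fin.Properties as Fin
open import Data.Fin.Subset using (Subset; _∈_; ∁; ∣_∣)
open import Data.Integer.Base using (+_)
open import Data.List.Base
  using (List; []; _∷_; _++_; allFin; filter; length; lookup; map; replicate; upTo)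
open import Data.List.Extrema.Nat using (max; min)
open import Data.Nat.Base using (ℕ; zero; suc; _+_; _*_; _∸_; _≤_)
open import Data.Nat.DivMod using (_/_)
import Data.Nat.Properties as ℕ
open import Data.Product.Base using (Σ; Σ-syntax; ∃-syntax; _×_; _,_; proj₁)
open import Data.Rational.Base as ℚ using (ℚ; 0ℚ)
open import Data.Sum.Base using (_⊎_)
open import Function.Bundles using (_↔_; _⇔_; Inverse)
open import Relation.Binary.PropositionalEquality using (_≡_; _≢_; refl; sym; ≢-sym)
open import Relation.Nullary using (¬_; Dec; yes; no)
open import Relation.Nullary.Decidable using (_×-dec_; ¬?)

-- A graph of order n is a Graph (Fin n).  Other vertex types occur as vertex
-- sets of induced subgraphs and of sequential joins.
record Graph (V : Set) : Set₁ where
  field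
    Adj       : V → V → Set
    adj?      : ∀ u v → Dec (Adj u v)
    symmetric : ∀ {u v} → Adj u v → Adj v u
    loopless  : ∀ {v} → ¬ Adj v v

open Graph public

infix 4 _≅_

_≅_ : {V W : Set} → Graph V → Graph W → Set
_≅_ {V} {W} G H =
  Σ[ f ∈ V ↔ W ] (∀ u v → Adj G u v ⇔ Adj H (Inverse.to f u) (Inverse.to f v))

-- Walks from u to v with m edges.
Walk : {V : Set} → Graph V → ℕ → V → V → Set
Walk G zero    u v = u ≡ v
Walk G (suc m) u v = ∃[ w ] Adj G u w × Walk G m w v

walk? : {n : ℕ} (G : Graph (Fin n)) (m : ℕ) (u v : Fin n) → Dec (Walk G m u v)
walk? G zero    u v = u Fin.≟ v
walk? G (suc m) u v = Fin.any? (λ w → adj? G u w ×-dec walk? G m w v)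

Connected : {V : Set} → Graph V → Set
Connected G = ∀ u v → ∃[ m ] Walk G m u v

degree : {n : ℕ} → Graph (Fin n) → Fin n → ℕ
degree {n} G v = length (filter (adj? G v) (allFin n))

-- In a graph of order n a shortest walk has fewer than n edges, so the search
-- is exhaustive; the value n is attained only when u and v are not connected.
distance : {n : ℕ} → Graph (Fin n) → Fin n → Fin n → ℕ
distance {n} G u v = min n (filter (λ m → walk? G m u v) (upTo n))

eccentricity : {n : ℕ} → Graph (Fin n) → Fin n → ℕ
eccentricity {n} G v = max 0 (map (distance G v) (allFin n))

diameter : {n : ℕ} → Graph (Fin n) → ℕ
diameter {n} G = max 0 (map (eccentricity G) (allFin n))

-- The zero-denominator clause is a convention: in a connected graph only the
-- vertex of a one-vertex graph has eccentricity 0.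
quotient : ℕ → ℕ → ℚ
quotient p zero    = 0ℚ
quotient p (suc q) = + p ℚ./ suc q

ξᶜᵉ : {n : ℕ} → Graph (Fin n) → ℚ
ξᶜᵉ G = sum ℚ.+-0-rawMonoid (λ v → quotient (degree G v) (eccentricity G v))

-- Membership v ∈ ∁ A, rather than ¬ (v ∈ A), has at most one proof, so each
-- remaining vertex occurs exactly once in the vertex type.
_∖_ : {n : ℕ} → Graph (Fin n) → (A : Subset n) → Graph (Σ[ v ∈ Fin n ] v ∈ ∁ A)
G ∖ A = record
  { Adj       = λ u v → Adj G (proj₁ u) (proj₁ v)
  ; adj?      = λ u v → adj? G (proj₁ u) (proj₁ v)
  ; symmetric = symmetric G
  ; loopless  = loopless G
  }

Separating : {n : ℕ} → Graph (Fin n) → Subset n → Set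
Separating G A = ¬ Connected (G ∖ A) ⊎ ∣ ∁ A ∣ ≡ 1

IsConnectivity : {n : ℕ} → Graph (Fin n) → ℕ → Set
IsConnectivity G κ =
    (∃[ A ] Separating G A × ∣ A ∣ ≡ κ)
  × (∀ A → Separating G A → κ ≤ ∣ A ∣)

_-Connected_ : {n : ℕ} → ℕ → Graph (Fin n) → Set
k -Connected G = ∃[ κ ] IsConnectivity G κ × k ≤ κ

𝔾 : (k n d : ℕ) → Graph (Fin n) → Set
𝔾 k n d G = Connected G × k -Connected G × diameter G ≡ d

K : (m : ℕ) → Graph (Fin m)
K m = record
  { Adj       = _≢_
  ; adj?      = λ u v → ¬? (u Fin.≟ v)
  ; symmetric = ≢-sym
  ; loopless  = λ v≢v → v≢v refl
  }

data JoinAdj {t : ℕ} {V : Fin t → Set} (M : ∀ i → Graph (V i)) :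
             Σ (Fin t) V → Σ (Fin t) V → Set where
  within   : ∀ {i x y} → Adj (M i) x y → JoinAdj M (i , x) (i , y)
  forward  : ∀ {i j x y} → toℕ j ≡ suc (toℕ i) → JoinAdj M (i , x) (j , y)
  backward : ∀ {i j x y} → toℕ i ≡ suc (toℕ j) → JoinAdj M (i , x) (j , y)

joinAdj? : {t : ℕ} {V : Fin t → Set} (M : ∀ i → Graph (V i)) →
           ∀ u v → Dec (JoinAdj M u v)
joinAdj? M (i , x) (j , y) with toℕ j ℕ.≟ suc (toℕ i) | toℕ i ℕ.≟ suc (toℕ j)
... | yes j≡1+i | _         = yes (forward j≡1+i)
... | no _      | yes i≡1+j = yes (backward i≡1+j)
... | no j≢1+i  | no i≢1+j  with i Fin.≟ j
...   | no i≢j = no λ { (within _)       → i≢j refl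
                      ; (forward j≡1+i)  → j≢1+i j≡1+i
                      ; (backward i≡1+j) → i≢1+j i≡1+j }
...   | yes refl with adj? (M i) x y
...     | yes xy = yes (within xy)
...     | no ¬xy = no λ { (within xy)      → ¬xy xy
                        ; (forward j≡1+i)  → j≢1+i j≡1+i
                        ; (backward i≡1+j) → i≢1+j i≡1+j }

-- The sequential join M₀ ∨ M₁ ∨ … of a finite family of disjoint graphs.
sequentialJoin : {t : ℕ} {V : Fin t → Set} → (∀ i → Graph (V i)) → Graph (Σ (Fin t) V)
sequentialJoin M = record
  { Adj       = JoinAdj M
  ; adj?      = joinAdj? M
  ; symmetric = λ { {i , _} (within xy) → within (symmetric (M i) xy)
                  ; (forward e)         → backward e
                  ; (backward e)        → forward e }
  ; loopless  = λ { {i , _} (within xx) → loopless (M i) xx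
                  ; (forward e)         → ℕ.1+n≢n (sym e)
                  ; (backward e)        → ℕ.1+n≢n (sym e) }
  }

CliqueJoinVertex : List ℕ → Set
CliqueJoinVertex ms = Σ[ i ∈ Fin (length ms) ] Fin (lookup ms i)

-- K m₁ ∨ K m₂ ∨ … ∨ K mₜ for ms = m₁ ∷ m₂ ∷ … ∷ mₜ ∷ [].
cliqueJoin : (ms : List ℕ) → Graph (CliqueJoinVertex ms)
cliqueJoin ms = sequentialJoin (λ i → K (lookup ms i))

-- Clique orders in G(n,k,d), d even.  The middle term is n - kd + 2k - 2.  When
-- that number is negative ∸ gives 0 and the orders sum to more than n, so no
-- graph of order n is isomorphic to the resulting join.
evenOrders : (n k d : ℕ) → List ℕ
evenOrders n k d =
  1 ∷ replicate ((d ∸ 2) / 2) k ++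
  (n + 2 * k ∸ (k * d + 2)) ∷ replicate ((d ∸ 2) / 2) k ++ 1 ∷ []

G⟨_,_,_⟩ : (n k d : ℕ) → Graph (CliqueJoinVertex (evenOrders n k d))
G⟨ n , k , d ⟩ = cliqueJoin (evenOrders n k d)

oddOrders : (k d s t : ℕ) → List ℕ
oddOrders k d s t =
  1 ∷ replicate ((d ∸ 3) / 2) k ++
  (s + 1) ∷ (t + 1) ∷ replicate ((d ∸ 3) / 2) k ++ 1 ∷ []

-- Membership in ℋ(n,k,d) up to isomorphism, d odd.  The equation is
-- s + t = n - kd + 3k - 4 with the subtracted terms moved to the left.
ℋ : (n k d : ℕ) {V : Set} → Graph V → Set
ℋ n k d G = ∃[ s ] ∃[ t ]
    k ∸ 1 ≤ s × k ∸ 1 ≤ t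
  × s + t + k * d + 4 ≡ n + 3 * k
  × G ≅ cliqueJoin (oddOrders k d s t)

{-# OPTIONS --safe #-}

-- Let G be maximal.  Sort its vertices by the distance from an end of a
-- diametral path.  Joining all vertices in the same or in consecutive levels
-- keeps the diameter and the connectivity, does not increase eccentricities and
-- increases degrees, so G already is the sequential join of its levels, and the
-- interior levels have at least k vertices because they separate the ends.  If
-- some level other than the middle one (or the two middle ones) has more
-- vertices than necessary, take an outermost such level and move one of its
-- vertices a step towards the middle: this strictly increases the index.

module Submission where

open import Defs
import Algebra.Definitions.RawMonoid as RM
open import Algebra.Properties.Semiring.Sum as SemiringSum using ()
open import Data.Bool.Base using (true)
open import Data.Fin.Base using (Fin; zero; suc; toℕ; fromℕ<; cast; _↑ʳ_)
import Data.Fin.Properties as Fin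
open import Data.Fin.Subset using (Subset; _∈_; ∁; ⁅_⁆; ∣_∣)
open import Data.Fin.Subset.Properties
  using (x∈∁p⇒x∉p; x∉p⇒x∈∁p; ∣∁p∣≡n∸∣p∣; ∣⁅x⁆∣≡1; ∣p∣≤n; p⊆q⇒∣p∣≤∣q∣; _∈?_; x∈⁅y⁆⇒x≡y)
import Data.Integer.Base as ℤ
import Data.Integer.Properties as ℤ
import Data.Integer.Tactic.RingSolver as ℤ using (solve-∀)
open import Data.List.Base
  using (List; []; _∷_; _++_; allFin; applyUpTo; filter; length; lookup; map; replicate; tabulate; upTo)
open import Data.List.Extrema.Nat
  using (max; argmax-sel; argmin-sel; min≤v⁺; v≤min⁺; min≤⊤; max≤v⁺; xs≤max)
open import Data.List.Membership.Propositional using (lose)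
open import Data.List.Membership.Propositional.Properties
  using (∈-filter⁺; ∈-filter⁻; ∈-upTo⁺; ∈-map⁺; ∈-map⁻; ∈-allFin)
open import Data.List.Properties using (lookup-applyUpTo; length-applyUpTo)
import Data.List.Relation.Unary.All as All
import Data.List.Relation.Unary.All.Properties as All
open import Data.Nat.Base hiding (∣_-_∣)
open import Data.Nat.Divisibility using (_∣_; divides; ∣-trans; m∣m*n; m≤n⇒m!∣n!)
open import Data.Nat.DivMod using (_/_; m/n*n≡m; m*n/n≡m; /-monoʳ-≤)
open import Data.Nat.Induction using (<-rec)
import Data.Nat.ListAction as ListAction
import Data.Nat.ListAction.Properties as ListAction
import Data.Nat.Properties as ℕ
open import Data.Nat.Tactic.RingSolver using (solve-∀)
open import Data.Product.Base using (Σ; ∃-syntax; _×_; _,_; proj₁; proj₂)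
import Data.Rational.Base as ℚ
import Data.Rational.Properties as ℚ
import Data.Rational.Unnormalised.Base as ℚᵘ
import Data.Rational.Unnormalised.Properties as ℚᵘ
open import Data.Sum.Base using (_⊎_; inj₁; inj₂)
import Data.Vec.Base as Vec
open import Data.Vec.Functional using (updateAt)
open import Data.Vec.Functional.Properties using (updateAt-updates; updateAt-minimal)
import Data.Vec.Properties as Vec
open import Data.Vec.Properties.WithK using ([]=-irrelevant)
open import Function.Base using (_∘_; id)
open import Function.Bundles using (_↔_; _⇔_; Inverse; Injection; mk↔ₛ′; mk⇔; Equivalence)
open import Function.Properties.Inverse using (↔⇒↣)
open import Relation.Binary.Definitions using (tri<; tri≈; tri>)
open import Relation.Binary.PropositionalEquality
open import Relation.Nullary using (¬_; Dec; yes; no; does; contradiction)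
open import Relation.Nullary.Decidable using (_×-dec_; ¬?; decidable-stable; dec-true)
open import Relation.Unary using (Decidable)

open SemiringSum ℕ.+-*-semiring
  using (sum; sum-cong-≗; ∑-distrib-+; *-distribˡ-sum; *-distribʳ-sum; sum-replicate-zero)

-- Moving a vertex `x` from level `i` to level `i + 1` costs it its neighbours on level `i - 1` and
-- brings it new ones on level `i + 2`. Taking an outermost surplus level controls the loss: level
-- `i - 1`, if there is one, then has its least size, at most `k`, while level `i + 2` is interior
-- and has at least `k` vertices. Shares do not decrease along these replacements, so a lost edge is
-- worth no more than a gained one, and `x` itself gets a larger share. A vertex on level `i` has
-- eccentricity max(i, d - i), which drops from `i` to `i + 1` precisely when `2 (i + 1) ≤ d`. This
-- is why one middle level for even `d`, and two for odd `d`, escape the argument; counting vertices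
-- then fixes the order of the one, or the sum of the two. All comparisons take place in the natural
-- numbers, after multiplication by `d !`, so that they are decidable and can be proved by
-- contradiction.

private
  variable
    n : ℕ
    P Q : Set

-- Indicators and finite sums

⟦_⟧ : Dec P → ℕ
⟦ yes _ ⟧ = 1
⟦ no _ ⟧  = 0

⟦⟧-true : (P? : Dec P) → P → ⟦ P? ⟧ ≡ 1
⟦⟧-true (yes _) _ = refl
⟦⟧-true (no ¬p) p = contradiction p ¬p

⟦⟧-false : (P? : Dec P) → ¬ P → ⟦ P? ⟧ ≡ 0
⟦⟧-false (yes p) ¬p = contradiction p ¬p
⟦⟧-false (no _)  _  = refl

⟦⟧-mono : (P? : Dec P) (Q? : Dec Q) → (P → Q) → ⟦ P? ⟧ ≤ ⟦ Q? ⟧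
⟦⟧-mono (yes p) Q? f = ℕ.≤-reflexive (sym (⟦⟧-true Q? (f p)))
⟦⟧-mono (no _)  Q? f = z≤n

⟦⟧-cong : (P? : Dec P) (Q? : Dec Q) → (P → Q) → (Q → P) → ⟦ P? ⟧ ≡ ⟦ Q? ⟧
⟦⟧-cong P? Q? f g = ℕ.≤-antisym (⟦⟧-mono P? Q? f) (⟦⟧-mono Q? P? g)

⟦⟧-×-dec : (P? : Dec P) (Q? : Dec Q) → ⟦ P? ×-dec Q? ⟧ ≡ ⟦ P? ⟧ * ⟦ Q? ⟧
⟦⟧-×-dec (yes _) (yes _) = refl
⟦⟧-×-dec (yes _) (no _)  = refl
⟦⟧-×-dec (no _)  _       = refl

sum-mono : {f g : Fin n → ℕ} → (∀ v → f v ≤ g v) → sum f ≤ sum g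
sum-mono {zero}  f≤g = z≤n
sum-mono {suc n} f≤g = ℕ.+-mono-≤ (f≤g zero) (sum-mono (f≤g ∘ suc))

sum-mono-< : {f g : Fin n → ℕ} → (∀ v → f v ≤ g v) → ∀ v → f v < g v → sum f < sum g
sum-mono-< f≤g zero    f<g = ℕ.+-mono-<-≤ f<g (sum-mono (f≤g ∘ suc))
sum-mono-< f≤g (suc v) f<g = ℕ.+-mono-≤-< (f≤g zero) (sum-mono-< (f≤g ∘ suc) v f<g)

term≤sum : (f : Fin n → ℕ) → ∀ v → f v ≤ sum f
term≤sum f zero    = ℕ.m≤m+n _ _
term≤sum f (suc v) = ℕ.≤-trans (term≤sum (f ∘ suc) v) (ℕ.m≤n+m _ _)

sum-zero : {f : Fin n → ℕ} → (∀ v → f v ≡ 0) → sum f ≡ 0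
sum-zero {n} f≡0 = trans (sum-cong-≗ f≡0) (sum-replicate-zero n)

sum-select : (x : Fin n) (f : Fin n → ℕ) → sum (λ v → ⟦ v Fin.≟ x ⟧ * f v) ≡ f x
sum-select {suc n} zero f =
  trans (cong (f zero + 0 +_) (sum-zero {n} λ v → cong (_* f (suc v)) (⟦⟧-false (suc v Fin.≟ zero) λ ())))
        (trans (ℕ.+-identityʳ _) (ℕ.+-identityʳ _))
sum-select (suc x) f =
  trans (sum-cong-≗ λ v → cong (_* f (suc v))
          (⟦⟧-cong (suc v Fin.≟ suc x) (v Fin.≟ x) Fin.suc-injective (cong suc)))
        (sum-select x (f ∘ suc))

-- The ordered pairs of distinct vertices are those avoiding x and those
-- containing x.
sum-pairs-split : (x : Fin n) (f : Fin n → Fin n → ℕ) →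
  sum (λ v → sum λ u → ⟦ ¬? (v Fin.≟ u) ⟧ * f v u) ≡
  sum (λ v → sum λ u → ⟦ ¬? (v Fin.≟ u) ⟧ * (⟦ ¬? (v Fin.≟ x) ⟧ * ⟦ ¬? (u Fin.≟ x) ⟧ * f v u)) +
  sum (λ u → ⟦ ¬? (u Fin.≟ x) ⟧ * (f x u + f u x))
sum-pairs-split x f = begin
  sum (λ v → sum λ u → d v u * f v u)
    ≡⟨ sum-cong-≗ (λ v → trans (sum-cong-≗ (split v)) (∑-distrib-+ (A v) (λ u → B v u + C v u))) ⟩
  sum (λ v → sum (A v) + sum λ u → B v u + C v u)
    ≡⟨ ∑-distrib-+ (λ v → sum (A v)) (λ v → sum λ u → B v u + C v u) ⟩
  sum (λ v → sum (A v)) + sum (λ v → sum λ u → B v u + C v u)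
    ≡⟨ cong (ΣA +_) (sum-cong-≗ λ v → ∑-distrib-+ (B v) (C v)) ⟩
  sum (λ v → sum (A v)) + sum (λ v → sum (B v) + sum (C v))
    ≡⟨ cong (ΣA +_) (∑-distrib-+ (λ v → sum (B v)) (λ v → sum (C v))) ⟩
  sum (λ v → sum (A v)) + (sum (λ v → sum (B v)) + sum (λ v → sum (C v)))
    ≡⟨ cong (ΣA +_) (cong₂ _+_ B-sum C-sum) ⟩
  sum (λ v → sum (A v)) + (sum b + sum c)
    ≡⟨ cong (ΣA +_) (sym (∑-distrib-+ b c)) ⟩
  sum (λ v → sum (A v)) + sum (λ u → b u + c u)
    ≡⟨ cong (ΣA +_) (sum-cong-≗ λ u → sym (ℕ.*-distribˡ-+ (e u) (f x u) (f u x))) ⟩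
  sum (λ v → sum (A v)) + sum (λ u → e u * (f x u + f u x)) ∎
  where
  open ≡-Reasoning
  d = λ v u → ⟦ ¬? (v Fin.≟ u) ⟧
  e = λ v → ⟦ ¬? (v Fin.≟ x) ⟧
  b = λ u → e u * f x u
  c = λ v → e v * f v x
  -- `A` carries the pairs avoiding `x`, `B` those with `v ≡ x`, `C` those with `u ≡ x`; in the last
  -- two the factor `e` discards the pair of `x` with itself.
  A = λ v u → d v u * (e v * e u * f v u)
  ΣA = sum λ v → sum (A v)
  B = λ v u → ⟦ v Fin.≟ x ⟧ * b u
  C = λ v u → ⟦ u Fin.≟ x ⟧ * (e v * f v u)

  B-sum : sum (λ v → sum (B v)) ≡ sum b
  B-sum = trans (sum-cong-≗ λ v → sym (*-distribˡ-sum ⟦ v Fin.≟ x ⟧ b)) (sum-select x (λ _ → sum b))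

  C-sum : sum (λ v → sum (C v)) ≡ sum c
  C-sum = sum-cong-≗ λ v → sum-select x (λ u → e v * f v u)

  split : ∀ v u → d v u * f v u ≡ A v u + (B v u + C v u)
  split v u with v Fin.≟ x | u Fin.≟ x | v Fin.≟ u
  ... | yes refl | yes refl | yes _    = refl
  ... | yes refl | yes refl | no v≢u   = contradiction refl v≢u
  ... | yes refl | no u≢x   | yes refl = contradiction refl u≢x
  ... | yes refl | no _     | no _     = solve₁ (f x u)
    where solve₁ : ∀ a → a + 0 ≡ a + 0 + 0 + 0
          solve₁ = solve-∀
  ... | no v≢x   | yes refl | yes refl = contradiction refl v≢x
  ... | no _     | yes refl | no _     = solve₂ (f v x)
    where solve₂ : ∀ a → a + 0 ≡ a + 0 + 0
          solve₂ = solve-∀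
  ... | no _     | no _     | yes _    = refl
  ... | no _     | no _     | no _     = solve₃ (f v u)
    where solve₃ : ∀ a → a + 0 ≡ a + 0 + 0 + 0
          solve₃ = solve-∀

length-filter-tabulate : {A : Set} {R : A → Set} (R? : Decidable R) (f : Fin n → A) →
  length (filter R? (tabulate f)) ≡ sum (λ v → ⟦ R? (f v) ⟧)
length-filter-tabulate {zero}  R? f = refl
length-filter-tabulate {suc n} R? f with R? (f zero)
... | yes _ = cong suc (length-filter-tabulate R? (f ∘ suc))
... | no _  = length-filter-tabulate R? (f ∘ suc)

-- Clearing denominators

-- Multiplying all reciprocals 1/e with 1 ≤ e ≤ d by d! turns sums of quotients
-- into natural numbers; share d 0 is a junk value.
share : ℕ → ℕ → ℕ
share d zero    = 0
share d (suc e) = d ! / suc e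

module _ {d : ℕ} where

  -- The division is exact: `e` divides `e !`, which divides `d !`.
  share-* : ∀ {e} → 1 ≤ e → e ≤ d → share d e * e ≡ d !
  share-* {suc e} _ e<d = m/n*n≡m (∣-trans (m∣m*n (e !)) (m≤n⇒m!∣n! e<d))

  share>0 : ∀ {e} → 1 ≤ e → e ≤ d → 1 ≤ share d e
  share>0 {e} 1≤e e≤d = ℕ.n≢0⇒n>0 λ s≡0 →
    ℕ.n>0⇒n≢0 (ℕ.1≤n! d) (trans (sym (share-* 1≤e e≤d)) (cong (_* e) s≡0))

  share-mono : ∀ {e e′} → 1 ≤ e → e ≤ e′ → share d e′ ≤ share d e
  share-mono {suc e} {suc e′} _ e≤e′ = /-monoʳ-≤ (d !) e≤e′

  -- Rounded quotients need not decrease strictly; exactness makes them do so, since otherwise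
  -- `d ! < d !`.
  share-mono-< : ∀ {e e′} → 1 ≤ e → e < e′ → e′ ≤ d → share d e′ < share d e
  share-mono-< {e} {e′} 1≤e e<e′ e′≤d = ℕ.≰⇒> λ s≤s′ → ℕ.<-irrefl refl (begin-strict
    d !            ≡⟨ share-* 1≤e (ℕ.≤-trans (ℕ.<⇒≤ e<e′) e′≤d) ⟨
    share d e * e  ≤⟨ ℕ.*-monoˡ-≤ e s≤s′ ⟩
    share d e′ * e <⟨ ℕ.*-monoʳ-< (share d e′) {{>-nonZero (share>0 1≤e′ e′≤d)}} e<e′ ⟩
    share d e′ * e′ ≡⟨ share-* 1≤e′ e′≤d ⟩
    d !            ∎)
    where
    open ℕ.≤-Reasoning
    1≤e′ = ℕ.≤-trans 1≤e (ℕ.<⇒≤ e<e′)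

scaledIndex : ℕ → Graph (Fin n) → ℕ
scaledIndex d G = sum (λ v → degree G v * share d (eccentricity G v))

-- The range in which `share d` is an exact quotient, so that `scaledIndex d G` is `d !` times
-- `ξᶜᵉ G`.
EccentricitiesIn[1,_] : ℕ → Graph (Fin n) → Set
EccentricitiesIn[1, d ] G = ∀ v → 1 ≤ eccentricity G v × eccentricity G v ≤ d

module _ (d : ℕ) where

  private instance
    d!≢0 : NonZero (d !)
    d!≢0 = d ℕ.!≢0

  quotient≃share : ∀ p {e} → 1 ≤ e → e ≤ d →
    ℚ.toℚᵘ (quotient p e) ℚᵘ.≃ (ℤ.+ (p * share d e)) ℚᵘ./ d !
  quotient≃share p {suc e} 1≤e e≤d = ℚᵘ.≃-trans (ℚ.toℚᵘ-fromℚᵘ (ℚᵘ.mkℚᵘ (ℤ.+ p) e)) (expand (d !) eq)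
    where
    eq : p * d ! ≡ p * share d (suc e) * suc e
    eq = trans (cong (p *_) (sym (share-* 1≤e e≤d))) (sym (ℕ.*-assoc p _ _))
    -- `d !` does not reduce to a successor, so the denominator is generalised to `D` before being
    -- matched as `suc D`. The same device serves in `0≃0/`, `add/` and `cancel/`.
    expand : ∀ D .{{_ : NonZero D}} → p * D ≡ p * share d (suc e) * suc e →
          ℚᵘ.mkℚᵘ (ℤ.+ p) e ℚᵘ.≃ (ℤ.+ (p * share d (suc e))) ℚᵘ./ D
    expand (suc D) eq = ℚᵘ.*≡* (trans (sym (ℤ.pos-* p (suc D)))
      (trans (cong ℤ.+_ eq) (ℤ.pos-* (p * share d (suc e)) (suc e))))

  sum≃ : (f : Fin n → ℚ.ℚ) (g : Fin n → ℕ) →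
    (∀ v → ℚ.toℚᵘ (f v) ℚᵘ.≃ (ℤ.+ g v) ℚᵘ./ d !) →
    ℚ.toℚᵘ (RM.sum ℚ.+-0-rawMonoid f) ℚᵘ.≃ (ℤ.+ sum g) ℚᵘ./ d !
  sum≃ {zero} f g f≃g = 0≃0/ (d !)
    where
    0≃0/ : ∀ D .{{_ : NonZero D}} → ℚ.toℚᵘ ℚ.0ℚ ℚᵘ.≃ (ℤ.+ 0) ℚᵘ./ D
    0≃0/ (suc D) = ℚᵘ.*≡* refl
  sum≃ {suc n} f g f≃g = ℚᵘ.≃-trans (ℚ.toℚᵘ-homo-+ (f zero) _)
    (ℚᵘ.≃-trans (ℚᵘ.+-cong (f≃g zero) (sum≃ (f ∘ suc) (g ∘ suc) (f≃g ∘ suc))) (add/ (d !)))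
    where
    a = g zero
    b = sum (g ∘ suc)
    add/ : ∀ D .{{_ : NonZero D}} → (ℤ.+ a) ℚᵘ./ D ℚᵘ.+ (ℤ.+ b) ℚᵘ./ D ℚᵘ.≃ (ℤ.+ (a + b)) ℚᵘ./ D
    add/ (suc D) = ℚᵘ.*≡* (distrib (ℤ.+ a) (ℤ.+ b) (ℤ.+ suc D))
      where distrib : ∀ x y z → (x ℤ.* z ℤ.+ y ℤ.* z) ℤ.* z ≡ (x ℤ.+ y) ℤ.* (z ℤ.* z)
            distrib = ℤ.solve-∀

  scaledIndex-mono : (G H : Graph (Fin n)) → EccentricitiesIn[1, d ] G → EccentricitiesIn[1, d ] H →
    ξᶜᵉ G ℚ.≤ ξᶜᵉ H → scaledIndex d G ≤ scaledIndex d H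
  scaledIndex-mono G H Gε Hε ξ≤ξ = cancel/ (d !)
    (ℚᵘ.≤-respˡ-≃ (ξ≃ G Gε) (ℚᵘ.≤-respʳ-≃ (ξ≃ H Hε) (ℚ.toℚᵘ-mono-≤ ξ≤ξ)))
    where
    ξ≃ : (G : Graph (Fin _)) → EccentricitiesIn[1, d ] G →
         ℚ.toℚᵘ (ξᶜᵉ G) ℚᵘ.≃ (ℤ.+ scaledIndex d G) ℚᵘ./ d !
    ξ≃ G Gε = sum≃ _ _ λ v → quotient≃share (degree G v) (proj₁ (Gε v)) (proj₂ (Gε v))
    cancel/ : ∀ D .{{_ : NonZero D}} {a b} → (ℤ.+ a) ℚᵘ./ D ℚᵘ.≤ (ℤ.+ b) ℚᵘ./ D → a ≤ b
    cancel/ (suc D) {a} {b} (ℚᵘ.*≤* aD≤bD) =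
      ℤ.drop‿+≤+ (ℤ.*-cancelʳ-≤-pos (ℤ.+ a) (ℤ.+ b) (ℤ.+ suc D) aD≤bD)

-- Distances in finite graphs

module _ (G : Graph (Fin n)) where

  walk-snoc : ∀ {m u v w} → Walk G m u v → Adj G v w → Walk G (suc m) u w
  walk-snoc {zero}  refl          vw = _ , vw , refl
  walk-snoc {suc m} (x , ux , xv) vw = x , ux , walk-snoc xv vw

  distance≤n : ∀ u v → distance G u v ≤ n
  distance≤n u v = min≤⊤ n (filter (λ m → walk? G m u v) (upTo n))

  distance≤ : ∀ {m u v} → Walk G m u v → distance G u v ≤ m
  distance≤ {m} {u} {v} uv with m ℕ.<? n
  ... | yes m<n = min≤v⁺ n _ (inj₂ (lose (∈-filter⁺ (λ m → walk? G m u v) (∈-upTo⁺ m<n) uv) ℕ.≤-refl))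
  ... | no m≮n  = ℕ.≤-trans (distance≤n _ _) (ℕ.≮⇒≥ m≮n)

  -- The hypothesis `e ≤ n` covers the default value `n` of the minimum; every other candidate is
  -- the length of a walk.
  ≤distance : ∀ {e u v} → e ≤ n → (∀ m → Walk G m u v → e ≤ m) → e ≤ distance G u v
  ≤distance {e} {u} {v} e≤n e≤walks = v≤min⁺ e≤n
    (All.tabulate λ m∈ → e≤walks _ (proj₂ (∈-filter⁻ (λ m → walk? G m u v) {xs = upTo n} m∈)))

  distance-attained : ∀ u v → distance G u v ≡ n ⊎ Walk G (distance G u v) u v
  distance-attained u v with argmin-sel id n (filter (λ m → walk? G m u v) (upTo n))
  ... | inj₁ ≡n = inj₁ ≡n
  ... | inj₂ m∈ = inj₂ (proj₂ (∈-filter⁻ (λ m → walk? G m u v) {xs = upTo n} m∈))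

  distance-step : ∀ {u v w} → Adj G v w → distance G u w ≤ suc (distance G u v)
  distance-step {u} {v} {w} vw with distance-attained u v
  -- Here `distance G u v` has the default value, which no distance exceeds.
  ... | inj₁ ≡n = ℕ.≤-trans (distance≤n _ _) (ℕ.≤-trans (ℕ.≤-reflexive (sym ≡n)) (ℕ.n≤1+n _))
  ... | inj₂ uv = distance≤ (walk-snoc uv vw)

private
  ≤max-map : (f : Fin n → ℕ) → ∀ v → f v ≤ max 0 (map f (allFin n))
  ≤max-map f v = All.lookup (xs≤max 0 _) (∈-map⁺ f (∈-allFin v))

  max-map≤ : (f : Fin n → ℕ) → ∀ {e} → (∀ v → f v ≤ e) → max 0 (map f (allFin n)) ≤ e
  max-map≤ f f≤e = max≤v⁺ {xs = map f (allFin _)} z≤n (All.map⁺ (All.tabulate λ {v} _ → f≤e v))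

  max-map-attained : (f : Fin n → ℕ) → 1 ≤ max 0 (map f (allFin n)) →
    ∃[ v ] f v ≡ max 0 (map f (allFin n))
  max-map-attained f 1≤max with argmax-sel id 0 (map f (allFin _))
  ... | inj₁ ≡0 = contradiction ≡0 (ℕ.m<n⇒n≢0 1≤max)
  ... | inj₂ m∈ with v , _ , eq ← ∈-map⁻ f m∈ = v , sym eq

module _ (G : Graph (Fin n)) where

  distance≤eccentricity : ∀ u v → distance G u v ≤ eccentricity G u
  distance≤eccentricity u = ≤max-map (distance G u)

  eccentricity≤ : ∀ {u e} → (∀ v → distance G u v ≤ e) → eccentricity G u ≤ e
  eccentricity≤ {u} = max-map≤ (distance G u)

  diameter≤ : ∀ {e} → (∀ v → eccentricity G v ≤ e) → diameter G ≤ e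
  diameter≤ = max-map≤ (eccentricity G)

  eccentricity≤diameter : ∀ v → eccentricity G v ≤ diameter G
  eccentricity≤diameter = ≤max-map (eccentricity G)

  diameter-attained : 1 ≤ diameter G → ∃[ u ] ∃[ v ] distance G u v ≡ diameter G
  diameter-attained 1≤d
    with u , εu≡d ← max-map-attained (eccentricity G) 1≤d
    with v , uv≡εu ← max-map-attained (distance G u) (ℕ.≤-trans 1≤d (ℕ.≤-reflexive (sym εu≡d)))
    = u , v , trans uv≡εu εu≡d

-- Level structures

Near : ℕ → ℕ → Set
Near a b = a ≤ suc b × b ≤ suc a

near? : ∀ a b → Dec (Near a b)
near? a b = (a ℕ.≤? suc b) ×-dec (b ℕ.≤? suc a)

near-sym : ∀ {a b} → Near a b → Near b a
near-sym (p , q) = q , p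

near-refl : ∀ {a} → Near a a
near-refl = ℕ.n≤1+n _ , ℕ.n≤1+n _

near-suc : ∀ {a} → Near a (suc a)
near-suc = ℕ.m≤n⇒m≤1+n (ℕ.n≤1+n _) , ℕ.≤-refl

-- The graph K_{n₀} ∨ … ∨ K_{n_d} on Fin n in which the i-th clique consists of
-- the vertices v with ℓ v ≡ i.
levelGraph : (Fin n → ℕ) → Graph (Fin n)
levelGraph ℓ = record
  { Adj       = λ u v → u ≢ v × Near (ℓ u) (ℓ v)
  ; adj?      = λ u v → ¬? (u Fin.≟ v) ×-dec near? (ℓ u) (ℓ v)
  ; symmetric = λ (u≢v , near) → u≢v ∘ sym , near-sym near
  ; loopless  = λ (v≢v , _) → v≢v refl
  }

levelSize : (Fin n → ℕ) → ℕ → ℕ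
levelSize ℓ i = sum (λ v → ⟦ ℓ v ℕ.≟ i ⟧)

-- In a k-connected graph of diameter d the interior distance levels have at
-- least k vertices.
least : (k d i : ℕ) → ℕ
least k d zero = 1
least k d (suc i) with suc i ℕ.≟ d
... | yes _ = 1
... | no _  = k

-- The distance levels of every graph in `𝔾 k n d` have these properties, and for `1 ≤ k` and
-- `3 ≤ d` they put `levelGraph ℓ` into `𝔾 k n d`, up to double negation. The extremal problem thus
-- becomes one about maps `ℓ`.
record Levelling (k d : ℕ) (ℓ : Fin n → ℕ) : Set where
  field
    bounded : ∀ v → ℓ v ≤ d
    large   : ∀ {i} → i ≤ d → least k d i ≤ levelSize ℓ i

open Levelling

least-end : ∀ k d → least k d d ≡ 1
least-end k zero = refl
least-end k (suc d) with suc d ℕ.≟ suc d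
... | yes _ = refl
... | no ≢  = contradiction refl ≢

least-interior : ∀ k {d i} → 0 < i → i < d → least k d i ≡ k
least-interior k {d} {suc i} _ i<d with suc i ℕ.≟ d
... | yes refl = contradiction i<d (ℕ.<-irrefl refl)
... | no _     = refl

1≤least : ∀ {k} d i → 1 ≤ k → 1 ≤ least k d i
1≤least d zero    1≤k = ℕ.≤-refl
1≤least d (suc i) 1≤k with suc i ℕ.≟ d
... | yes _ = ℕ.≤-refl
... | no _  = 1≤k

least≤ : ∀ {k} d i → 1 ≤ k → least k d i ≤ k
least≤ d zero    1≤k = 1≤k
least≤ d (suc i) 1≤k with suc i ℕ.≟ d
... | yes _ = 1≤k
... | no _  = ℕ.≤-refl

levelSize>0⇒inhabited : (ℓ : Fin n → ℕ) → ∀ i → 1 ≤ levelSize ℓ i → ∃[ v ] ℓ v ≡ i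
levelSize>0⇒inhabited ℓ i 1≤c with Fin.any? (λ v → ℓ v ℕ.≟ i)
... | yes v   = v
... | no none = contradiction (sum-zero λ v → ⟦⟧-false (ℓ v ℕ.≟ i) λ eq → none (v , eq)) (ℕ.m<n⇒n≢0 1≤c)

levelSet : (Fin n → ℕ) → ℕ → Subset n
levelSet ℓ i = Vec.tabulate (λ v → does (ℓ v ℕ.≟ i))

∈-levelSet⁺ : (ℓ : Fin n → ℕ) → ∀ {i v} → ℓ v ≡ i → v ∈ levelSet ℓ i
∈-levelSet⁺ ℓ {i} {v} eq =
  Vec.lookup⇒[]= v _ (trans (Vec.lookup∘tabulate _ v) (dec-true (ℓ v ℕ.≟ i) eq))

∈-levelSet⁻ : (ℓ : Fin n → ℕ) → ∀ {i v} → v ∈ levelSet ℓ i → ℓ v ≡ i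
∈-levelSet⁻ ℓ {i} {v} v∈ = does-true (ℓ v ℕ.≟ i) (trans (sym (Vec.lookup∘tabulate _ v)) (Vec.[]=⇒lookup v∈))
  where
  does-true : {P : Set} (P? : Dec P) → does P? ≡ true → P
  does-true (yes p) _ = p

∣tabulate-does∣ : {R : Fin n → Set} (R? : Decidable R) →
  ∣ Vec.tabulate (λ v → does (R? v)) ∣ ≡ sum (λ v → ⟦ R? v ⟧)
∣tabulate-does∣ {zero}  R? = refl
∣tabulate-does∣ {suc n} R? with R? zero
... | yes _ = cong suc (∣tabulate-does∣ (R? ∘ suc))
... | no _  = ∣tabulate-does∣ (R? ∘ suc)

∣levelSet∣ : (ℓ : Fin n → ℕ) → ∀ i → ∣ levelSet ℓ i ∣ ≡ levelSize ℓ i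
∣levelSet∣ ℓ i = ∣tabulate-does∣ (λ v → ℓ v ℕ.≟ i)

-- Walks in level structures

-- V is the vertex set of a level graph, possibly with vertices removed.
module LevelWalks {V : Set} (G : Graph V) (ℓ : V → ℕ) (d : ℕ)
  (near⇒adj : ∀ u v → Near (ℓ u) (ℓ v) → u ≡ v ⊎ Adj G u v)
  (bounded  : ∀ v → ℓ v ≤ d)
  (interior : ∀ {i} → 0 < i → i < d → ∃[ v ] ℓ v ≡ i)
  where

  private
    adj : ∀ {u v} → Near (ℓ u) (ℓ v) → ℓ u ≢ ℓ v → Adj G u v
    adj {u} {v} near ℓu≢ℓv with near⇒adj u v near
    ... | inj₁ refl = contradiction refl ℓu≢ℓv
    ... | inj₂ uv   = uv

  -- The inner vertices of a monotone walk lie strictly between the levels of its ends, hence on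
  -- interior levels. So only these must be inhabited, and the construction survives the deletion of
  -- both end levels.
  ascend : ∀ m {u v} → ℓ v ≡ suc m + ℓ u → Walk G (suc m) u v
  ascend zero {u} {v} eq = v ,
    adj (subst (Near (ℓ u)) (sym eq) near-suc) (λ ≡ℓ → ℕ.1+n≢n (trans (sym eq) (sym ≡ℓ))) , refl
  ascend (suc m) {u} {v} eq
    with w , w≡ ← interior {suc (ℓ u)} (s≤s z≤n)
           (ℕ.≤-trans (ℕ.≤-trans (s≤s (s≤s (ℕ.m≤n+m (ℓ u) m))) (ℕ.≤-reflexive (sym eq))) (bounded v))
    = w , adj (subst (Near (ℓ u)) (sym w≡) near-suc) (λ ≡ℓ → ℕ.1+n≢n (trans (sym w≡) (sym ≡ℓ)))
        , ascend m (trans eq (trans (sym (ℕ.+-suc (suc m) (ℓ u))) (cong (suc m +_) (sym w≡))))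

  descend : ∀ m {u v} → ℓ u ≡ suc m + ℓ v → Walk G (suc m) u v
  descend zero {u} {v} eq = v ,
    adj (near-sym (subst (Near (ℓ v)) (sym eq) near-suc)) (λ ≡ℓ → ℕ.1+n≢n (trans (sym eq) ≡ℓ)) , refl
  descend (suc m) {u} {v} eq
    with w , w≡ ← interior {suc m + ℓ v} (s≤s z≤n) (ℕ.≤-trans (ℕ.≤-reflexive (sym eq)) (bounded u))
    = w , adj (near-sym (subst (Near (ℓ w)) (trans (cong suc w≡) (sym eq)) near-suc))
              (λ ≡ℓ → ℕ.1+n≢n (trans (sym eq) (trans ≡ℓ w≡)))
        , descend m w≡

  -- On a common level one edge suffices; otherwise the length is the difference of the levels,
  -- upwards or downwards. Each alternative is later bounded by `levelEccentricity`.
  ShortWalk : V → V → Set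
  ShortWalk u v = ∃[ m ] Walk G m u v × (m ≤ 1 ⊎ ℓ v ≡ m + ℓ u ⊎ ℓ u ≡ m + ℓ v)

  shortWalk : ∀ u v → ShortWalk u v
  shortWalk u v with ℕ.<-cmp (ℓ u) (ℓ v)
  ... | tri≈ _ ℓu≡ℓv _ with near⇒adj u v (subst (Near (ℓ u)) ℓu≡ℓv near-refl)
  ...   | inj₁ refl = 0 , refl , inj₁ z≤n
  ...   | inj₂ uv   = 1 , (v , uv , refl) , inj₁ (s≤s z≤n)
  shortWalk u v | tri< ℓu<ℓv _ _ = _ , ascend (ℓ v ∸ suc (ℓ u)) eq , inj₂ (inj₁ eq)
    where eq = sym (trans (sym (ℕ.+-suc _ (ℓ u))) (ℕ.m∸n+n≡m ℓu<ℓv))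
  shortWalk u v | tri> _ _ ℓv<ℓu = _ , descend (ℓ u ∸ suc (ℓ v)) eq , inj₂ (inj₂ eq)
    where eq = sym (trans (sym (ℕ.+-suc _ (ℓ v))) (ℕ.m∸n+n≡m ℓv<ℓu))

  connected : Connected G
  connected u v = _ , proj₁ (proj₂ (shortWalk u v))

walk-level : {V : Set} (G : Graph V) (ℓ : V → ℕ) → (∀ {u v} → Adj G u v → Near (ℓ u) (ℓ v)) →
  ∀ m {u v} → Walk G m u v → ℓ u ≤ m + ℓ v × ℓ v ≤ m + ℓ u
walk-level G ℓ lip zero    refl          = ℕ.≤-refl , ℕ.≤-refl
walk-level G ℓ lip (suc m) {u} {v} (w , uw , wv)
  with ℓu≤ , ℓw≤ ← lip uw | ℓw≤m , ℓv≤m ← walk-level G ℓ lip m wv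
  = ℕ.≤-trans ℓu≤ (s≤s ℓw≤m)
  , ℕ.≤-trans ℓv≤m (ℕ.≤-trans (ℕ.+-monoʳ-≤ m ℓw≤) (ℕ.≤-reflexive (ℕ.+-suc m (ℓ u))))

-- The difference from level `i` to the farther of the end levels 0 and `d`.
levelEccentricity : (d i : ℕ) → ℕ
levelEccentricity d i = i ⊔ (d ∸ i)

module _ {k d : ℕ} (1≤k : 1 ≤ k) {ℓ : Fin n → ℕ} (L : Levelling k d ℓ) where

  inhabited : ∀ {i} → i ≤ d → ∃[ v ] ℓ v ≡ i
  inhabited {i} i≤d = levelSize>0⇒inhabited ℓ i (ℕ.≤-trans (1≤least d i 1≤k) (large L i≤d))

  k≤levelSize : ∀ {i} → 0 < i → i < d → k ≤ levelSize ℓ i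
  k≤levelSize 0<i i<d = subst (_≤ _) (least-interior k 0<i i<d) (large L (ℕ.<⇒≤ i<d))

  -- One representative per level gives `suc d` distinct vertices. The bound supplies the hypothesis
  -- `e ≤ n` of `≤distance`.
  diameter<order : d < n
  diameter<order = Fin.injective⇒≤ {f = rep} λ {i} {j} eq →
    Fin.toℕ-injective (trans (sym (ℓ-rep i)) (trans (cong ℓ eq) (ℓ-rep j)))
    where
    rep : Fin (suc d) → Fin n
    rep i = proj₁ (inhabited (Fin.toℕ≤pred[n] i))
    ℓ-rep : ∀ i → ℓ (rep i) ≡ toℕ i
    ℓ-rep i = proj₂ (inhabited (Fin.toℕ≤pred[n] i))

  -- An edge changes the level by at most one, so from `v` at least `ℓ v` edges lead to level 0 and
  -- at least `d ∸ ℓ v` to level `d`.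
  levelEccentricity≤ : (G : Graph (Fin n)) → (∀ {u v} → Adj G u v → Near (ℓ u) (ℓ v)) →
    ∀ v → levelEccentricity d (ℓ v) ≤ eccentricity G v
  levelEccentricity≤ G lip v
    with a , a≡0 ← inhabited z≤n | b , b≡d ← inhabited ℕ.≤-refl = ℕ.⊔-lub
    (ℕ.≤-trans (≤distance G (ℕ.≤-trans (bounded L v) (ℕ.<⇒≤ diameter<order))
       λ m va → subst (ℓ v ≤_) (trans (cong (m +_) a≡0) (ℕ.+-identityʳ m)) (proj₁ (walk-level G ℓ lip m va)))
      (distance≤eccentricity G v a))
    (ℕ.≤-trans (≤distance G (ℕ.≤-trans (ℕ.m∸n≤m d (ℓ v)) (ℕ.<⇒≤ diameter<order))
       λ m vb → ℕ.m≤n+o⇒m∸n≤o d (ℓ v) (subst₂ _≤_ b≡d (ℕ.+-comm m (ℓ v)) (proj₂ (walk-level G ℓ lip m vb))))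
      (distance≤eccentricity G v b))

1≤levelEccentricity : ∀ {d} → 1 ≤ d → ∀ i → 1 ≤ levelEccentricity d i
1≤levelEccentricity {d} 1≤d zero    = 1≤d
1≤levelEccentricity {d} 1≤d (suc i) = ℕ.≤-trans (s≤s z≤n) (ℕ.m≤m⊔n (suc i) (d ∸ suc i))

levelEccentricity≤d : ∀ {d i} → i ≤ d → levelEccentricity d i ≤ d
levelEccentricity≤d {d} {i} i≤d = ℕ.⊔-lub i≤d (ℕ.m∸n≤m d i)

-- Connectivity

-- If there is no least element, strong induction refutes `P` everywhere. As `P` may be undecidable,
-- a least element is obtained only up to double negation.
¬¬-least : (P : ℕ → Set) → ∀ {m} → P m → ¬ ¬ (∃[ κ ] P κ × (∀ j → P j → κ ≤ j))
¬¬-least P {m} pm none = <-rec (λ m → ¬ P m)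
  (λ m ih pm → none (m , pm , λ j pj → ℕ.≮⇒≥ λ j<m → ih j<m pj)) m pm

¬¬-connected : ∀ {k} (G : Graph (Fin n)) → 1 ≤ n →
  (∀ A → Separating G A → k ≤ ∣ A ∣) → ¬ ¬ (k -Connected G)
¬¬-connected {suc n} {k} G _ k≤ ¬conn =
  -- Deleting all vertices but `v` leaves a single vertex, so some separating set exists.
  ¬¬-least (λ κ → ∃[ A ] Separating G A × ∣ A ∣ ≡ κ) (∁ ⁅ v ⁆ , inj₂ single , refl)
    λ { (κ , (A , sep , ∣A∣≡κ) , min) → ¬conn
          (κ , ((A , sep , ∣A∣≡κ) , λ B sepB → min _ (B , sepB , refl))
             , subst (k ≤_) ∣A∣≡κ (k≤ A sep)) }
  where
  v = zero
  single : ∣ ∁ (∁ ⁅ v ⁆) ∣ ≡ 1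
  single = trans (∣∁p∣≡n∸∣p∣ (∁ ⁅ v ⁆)) (trans (cong (suc n ∸_) (trans (∣∁p∣≡n∸∣p∣ ⁅ v ⁆)
    (cong (suc n ∸_) (∣⁅x⁆∣≡1 v)))) (trans (ℕ.+-∸-assoc 1 (ℕ.≤-refl {n})) (cong suc (ℕ.n∸n≡0 n))))

-- A walk cannot jump over level `i`, so in its absence it stays below once it starts below.
level-separates : (G : Graph (Fin n)) (ℓ : Fin n → ℕ) → (∀ {u v} → Adj G u v → Near (ℓ u) (ℓ v)) →
  ∀ {i u v} → ℓ u < i → i < ℓ v → Separating G (levelSet ℓ i)
level-separates G ℓ lip {i} {u} {v} ℓu<i i<ℓv = inj₁ λ conn →
  ℕ.<-asym i<ℓv (stays-below (proj₁ (conn (u , outside (ℕ.<⇒≢ ℓu<i)) (v , outside (ℕ.>⇒≢ i<ℓv))))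
                             (proj₂ (conn _ _)) ℓu<i)
  where
  outside : ∀ {w} → ℓ w ≢ i → w ∈ ∁ (levelSet ℓ i)
  outside ℓw≢i = x∉p⇒x∈∁p (ℓw≢i ∘ ∈-levelSet⁻ ℓ)
  stays-below : ∀ m {x y} → Walk (G ∖ levelSet ℓ i) m x y → ℓ (proj₁ x) < i → ℓ (proj₁ y) < i
  stays-below zero    refl                   x<i = x<i
  stays-below (suc m) ((w , w∈) , xw , wy) x<i = stays-below m wy
    (ℕ.≤∧≢⇒< (ℕ.≤-trans (proj₂ (lip xw)) x<i) λ ≡i → x∈∁p⇒x∉p w∈ (∈-levelSet⁺ ℓ ≡i))

module _ {k d : ℕ} (1≤k : 1 ≤ k) (3≤d : 3 ≤ d) {ℓ : Fin n → ℕ} (L : Levelling k d ℓ) where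

  private
    near⇒adj : ∀ u v → Near (ℓ u) (ℓ v) → u ≡ v ⊎ Adj (levelGraph ℓ) u v
    near⇒adj u v near with u Fin.≟ v
    ... | yes u≡v = inj₁ u≡v
    ... | no u≢v  = inj₂ (u≢v , near)

    module W = LevelWalks (levelGraph ℓ) ℓ d near⇒adj (bounded L) (λ _ i<d → inhabited 1≤k L (ℕ.<⇒≤ i<d))

    1≤d : 1 ≤ d
    1≤d = ℕ.≤-trans (s≤s z≤n) 3≤d

  levelGraph-eccentricity : ∀ v → eccentricity (levelGraph ℓ) v ≡ levelEccentricity d (ℓ v)
  levelGraph-eccentricity u = ℕ.≤-antisym
    (eccentricity≤ (levelGraph ℓ) λ v → ℕ.≤-trans (distance≤ (levelGraph ℓ) (proj₁ (proj₂ (W.shortWalk u v))))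
                                        (short v (proj₂ (proj₂ (W.shortWalk u v)))))
    (levelEccentricity≤ 1≤k L (levelGraph ℓ) proj₂ u)
    where
    short : ∀ v {m} → m ≤ 1 ⊎ ℓ v ≡ m + ℓ u ⊎ ℓ u ≡ m + ℓ v → m ≤ levelEccentricity d (ℓ u)
    short v (inj₁ m≤1) = ℕ.≤-trans m≤1 (1≤levelEccentricity 1≤d (ℓ u))
    short v {m} (inj₂ (inj₁ ℓv≡)) = ℕ.≤-trans
      (ℕ.m+n≤o⇒m≤o∸n m (ℕ.≤-trans (ℕ.≤-reflexive (sym ℓv≡)) (bounded L v))) (ℕ.m≤n⊔m (ℓ u) (d ∸ ℓ u))
    short v {m} (inj₂ (inj₂ ℓu≡)) = ℕ.≤-trans
      (ℕ.≤-trans (ℕ.m≤m+n m (ℓ v)) (ℕ.≤-reflexive (sym ℓu≡))) (ℕ.m≤m⊔n (ℓ u) (d ∸ ℓ u))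

  levelGraph-diameter : diameter (levelGraph ℓ) ≡ d
  levelGraph-diameter = ℕ.≤-antisym
    (diameter≤ (levelGraph ℓ) λ v → ℕ.≤-trans (ℕ.≤-reflexive (levelGraph-eccentricity v)) (levelEccentricity≤d (bounded L v)))
    (subst (_≤ _) (trans (levelGraph-eccentricity a) (cong (levelEccentricity d) a≡0)) (eccentricity≤diameter (levelGraph ℓ) a))
    where
    a   = proj₁ (inhabited 1≤k L z≤n)
    a≡0 = proj₂ (inhabited 1≤k L z≤n)

  -- Fewer than `k` deletions leave a vertex on every interior level, and then monotone walks
  -- connect the rest.
  levelGraph-separating : ∀ A → Separating (levelGraph ℓ) A → k ≤ ∣ A ∣
  levelGraph-separating A (inj₂ single) = begin
    -- Here `A` has `n ∸ 1` vertices. Level 1 is interior and misses `a`, which lies on level 0, so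
    -- `k ≤ n ∸ 1`.
    k                   ≤⟨ k≤levelSize 1≤k L (s≤s z≤n) (ℕ.≤-trans (ℕ.n≤1+n 2) 3≤d) ⟩
    levelSize ℓ 1       ≡⟨ ∣levelSet∣ ℓ 1 ⟨
    ∣ levelSet ℓ 1 ∣    ≤⟨ p⊆q⇒∣p∣≤∣q∣ (λ v∈ → x∉p⇒x∈∁p λ v∈a →
                            ℕ.0≢1+n (trans (sym a≡0) (trans (cong ℓ (sym (x∈⁅y⁆⇒x≡y a v∈a))) (∈-levelSet⁻ ℓ v∈)))) ⟩
    ∣ ∁ ⁅ a ⁆ ∣         ≡⟨ trans (∣∁p∣≡n∸∣p∣ ⁅ a ⁆) (cong (n ∸_) (∣⁅x⁆∣≡1 a)) ⟩
    n ∸ 1               ≡⟨ cong (n ∸_) (trans (sym single) (∣∁p∣≡n∸∣p∣ A)) ⟩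
    n ∸ (n ∸ ∣ A ∣)     ≡⟨ ℕ.m∸[m∸n]≡n (∣p∣≤n A) ⟩
    ∣ A ∣               ∎
    where
    open ℕ.≤-Reasoning
    a   = proj₁ (inhabited 1≤k L z≤n)
    a≡0 = proj₂ (inhabited 1≤k L z≤n)
  levelGraph-separating A (inj₁ ¬conn) = decidable-stable (k ℕ.≤? ∣ A ∣) λ k≰∣A∣ →
    ¬conn (LevelWalks.connected (levelGraph ℓ ∖ A) (ℓ ∘ proj₁) d remaining (bounded L ∘ proj₁) (survivor k≰∣A∣))
    where
    remaining : ∀ u v → Near (ℓ (proj₁ u)) (ℓ (proj₁ v)) → u ≡ v ⊎ Adj (levelGraph ℓ ∖ A) u v
    remaining (u , u∈) (v , v∈) near with near⇒adj u v near
    ... | inj₁ refl = inj₁ (cong (u ,_) ([]=-irrelevant u∈ v∈))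
    ... | inj₂ uv   = inj₂ uv
    survivor : ¬ (k ≤ ∣ A ∣) → ∀ {i} → 0 < i → i < d → ∃[ v ] ℓ (proj₁ {B = _∈ ∁ A} v) ≡ i
    survivor k≰∣A∣ {i} 0<i i<d with Fin.any? (λ v → (ℓ v ℕ.≟ i) ×-dec ¬? (v ∈? A))
    ... | yes (v , ℓv≡i , v∉A) = (v , x∉p⇒x∈∁p v∉A) , ℓv≡i
    ... | no none = contradiction
      (ℕ.≤-trans (k≤levelSize 1≤k L 0<i i<d) (subst (_≤ ∣ A ∣) (∣levelSet∣ ℓ i) (p⊆q⇒∣p∣≤∣q∣ λ {v} v∈ →
        decidable-stable (v ∈? A) λ v∉A → none (v , ∈-levelSet⁻ ℓ v∈ , v∉A))))
      k≰∣A∣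

  -- The connectivity itself is not computed: a double negation suffices, since
  -- membership in 𝔾 is only used to refute inequalities.
  levelGraph∈𝔾 : ¬ ¬ 𝔾 k n d (levelGraph ℓ)
  levelGraph∈𝔾 ¬𝔾 = ¬¬-connected (levelGraph ℓ) (ℕ.≤-trans (s≤s z≤n) (diameter<order 1≤k L)) levelGraph-separating
    λ k-conn → ¬𝔾 (W.connected , k-conn , levelGraph-diameter)

-- Distance levels

distance-levelling : ∀ {k d} → 1 ≤ k → 3 ≤ d → (G : Graph (Fin n)) → 𝔾 k n d G →
  ∃[ ℓ ] Levelling k d ℓ × (∀ {u v} → Adj G u v → Near (ℓ u) (ℓ v))
distance-levelling {n} {k} {d} 1≤k 3≤d G (conn , (κ , (_ , κ-least) , k≤κ) , diam) = ℓ , L , lip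
  where
  ends = diameter-attained G (subst (1 ≤_) (sym diam) (ℕ.≤-trans (s≤s z≤n) 3≤d))
  a = proj₁ ends
  b = proj₁ (proj₂ ends)
  ℓ = distance G a

  ℓa≡0 : ℓ a ≡ 0
  ℓa≡0 = ℕ.n≤0⇒n≡0 (distance≤ G {m = 0} refl)

  ℓb≡d : ℓ b ≡ d
  ℓb≡d = trans (proj₂ (proj₂ ends)) diam

  lip : ∀ {u v} → Adj G u v → Near (ℓ u) (ℓ v)
  lip uv = distance-step G (symmetric G uv) , distance-step G uv

  inhabited⇒size : ∀ {v} i → ℓ v ≡ i → 1 ≤ levelSize ℓ i
  inhabited⇒size {v} i ℓv≡i = subst (_≤ levelSize ℓ i) (⟦⟧-true (ℓ v ℕ.≟ i) ℓv≡i) (term≤sum (λ v → ⟦ ℓ v ℕ.≟ i ⟧) v)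

  L : Levelling k d ℓ
  L .bounded v = subst (ℓ v ≤_) diam (ℕ.≤-trans (distance≤eccentricity G a v) (eccentricity≤diameter G a))
  L .large {zero}  _   = inhabited⇒size 0 ℓa≡0
  L .large {suc i} i≤d with suc i ℕ.≟ d
  ... | yes refl = inhabited⇒size d ℓb≡d
  ... | no i≢d   = ℕ.≤-trans k≤κ (subst (κ ≤_) (∣levelSet∣ ℓ (suc i)) (κ-least (levelSet ℓ (suc i))
    (level-separates G ℓ lip (subst (_< suc i) (sym ℓa≡0) (s≤s z≤n))
                             (subst (suc i <_) (sym ℓb≡d) (ℕ.≤∧≢⇒< i≤d i≢d)))))

-- The index of a level graph

levelShare : (d i : ℕ) → ℕ
levelShare d i = share d (levelEccentricity d i)

-- A double sum over ordered pairs of distinct vertices instead of a sum over degrees: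
-- `sum-pairs-split` can then isolate the terms that involve a moved vertex.
levelIndex : ℕ → (Fin n → ℕ) → ℕ
levelIndex d ℓ =
  sum λ v → sum λ u → ⟦ ¬? (v Fin.≟ u) ⟧ * (⟦ near? (ℓ v) (ℓ u) ⟧ * levelShare d (ℓ v))

degree-sum : (G : Graph (Fin n)) → ∀ v → degree G v ≡ sum (λ u → ⟦ adj? G v u ⟧)
degree-sum G v = length-filter-tabulate (adj? G v) id

levelIndex-degree : ∀ d (ℓ : Fin n → ℕ) →
  levelIndex d ℓ ≡ sum (λ v → degree (levelGraph ℓ) v * levelShare d (ℓ v))
levelIndex-degree d ℓ = sym (sum-cong-≗ λ v → begin
  degree (levelGraph ℓ) v * levelShare d (ℓ v)
    ≡⟨ cong (_* levelShare d (ℓ v)) (degree-sum (levelGraph ℓ) v) ⟩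
  sum (λ u → ⟦ adj? (levelGraph ℓ) v u ⟧) * levelShare d (ℓ v)
    ≡⟨ *-distribʳ-sum (levelShare d (ℓ v)) (λ u → ⟦ adj? (levelGraph ℓ) v u ⟧) ⟩
  sum (λ u → ⟦ adj? (levelGraph ℓ) v u ⟧ * levelShare d (ℓ v))
    ≡⟨ sum-cong-≗ (λ u → trans (cong (_* levelShare d (ℓ v)) (⟦⟧-×-dec (¬? (v Fin.≟ u)) (near? (ℓ v) (ℓ u))))
                               (ℕ.*-assoc ⟦ ¬? (v Fin.≟ u) ⟧ _ _)) ⟩
  sum (λ u → ⟦ ¬? (v Fin.≟ u) ⟧ * (⟦ near? (ℓ v) (ℓ u) ⟧ * levelShare d (ℓ v))) ∎)
  where open ≡-Reasoning

module _ {k d : ℕ} (1≤k : 1 ≤ k) (3≤d : 3 ≤ d) {ℓ : Fin n → ℕ} (L : Levelling k d ℓ) where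

  private
    1≤ε : ∀ v → 1 ≤ levelEccentricity d (ℓ v)
    1≤ε v = 1≤levelEccentricity (ℕ.≤-trans (s≤s z≤n) 3≤d) (ℓ v)

  levelIndex-scaled : scaledIndex d (levelGraph ℓ) ≡ levelIndex d ℓ
  levelIndex-scaled = trans
    (sum-cong-≗ λ v → cong (λ e → degree (levelGraph ℓ) v * share d e) (levelGraph-eccentricity 1≤k 3≤d L v))
    (sym (levelIndex-degree d ℓ))

  module _ (G : Graph (Fin n)) (lip : ∀ {u v} → Adj G u v → Near (ℓ u) (ℓ v)) where

    private
      adj-levelGraph : ∀ {u v} → Adj G u v → Adj (levelGraph ℓ) u v
      adj-levelGraph uv = (λ { refl → loopless G uv }) , lip uv

      adj-mono : ∀ v u → ⟦ adj? G v u ⟧ ≤ ⟦ adj? (levelGraph ℓ) v u ⟧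
      adj-mono v u = ⟦⟧-mono (adj? G v u) (adj? (levelGraph ℓ) v u) adj-levelGraph

      degree-mono : ∀ v → degree G v ≤ degree (levelGraph ℓ) v
      degree-mono v = subst₂ _≤_ (sym (degree-sum G v)) (sym (degree-sum (levelGraph ℓ) v)) (sum-mono (adj-mono v))

      share≤ : ∀ v → share d (eccentricity G v) ≤ levelShare d (ℓ v)
      share≤ v = share-mono (1≤ε v) (levelEccentricity≤ 1≤k L G lip v)

      term≤ : ∀ v → degree G v * share d (eccentricity G v) ≤ degree (levelGraph ℓ) v * levelShare d (ℓ v)
      term≤ v = ℕ.*-mono-≤ (degree-mono v) (share≤ v)

    scaledIndex≤levelIndex : scaledIndex d G ≤ levelIndex d ℓ
    scaledIndex≤levelIndex = subst (_ ≤_) (sym (levelIndex-degree d ℓ)) (sum-mono term≤)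

    scaledIndex<levelIndex : ∀ {v u} → Adj (levelGraph ℓ) v u → ¬ Adj G v u → scaledIndex d G < levelIndex d ℓ
    scaledIndex<levelIndex {v} {u} vu ¬vu = subst (_ <_) (sym (levelIndex-degree d ℓ)) (sum-mono-< term≤ v
      -- Raising the share is weak, raising the degree is strict because the new share is positive.
      (ℕ.≤-<-trans (ℕ.*-monoʳ-≤ (degree G v) (share≤ v))
        (ℕ.*-monoˡ-< (levelShare d (ℓ v)) {{>-nonZero (share>0 (1≤ε v) (levelEccentricity≤d (bounded L v)))}} degree<)))
      where
      degree< : degree G v < degree (levelGraph ℓ) v
      degree< = subst₂ _<_ (sym (degree-sum G v)) (sym (degree-sum (levelGraph ℓ) v))
        (sum-mono-< (adj-mono v) u (subst₂ _<_ (sym (⟦⟧-false (adj? G v u) ¬vu))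
                                               (sym (⟦⟧-true (adj? (levelGraph ℓ) v u) vu)) (s≤s z≤n)))

-- Moving a vertex towards the middle

levelEccentricity-lower : ∀ {d} i → i + i ≤ d → levelEccentricity d i ≡ d ∸ i
levelEccentricity-lower i 2i≤d = ℕ.m≤n⇒m⊔n≡n (ℕ.m+n≤o⇒m≤o∸n i 2i≤d)

module _ {d i : ℕ} (1≤d : 1 ≤ d) (2+2i≤d : suc i + suc i ≤ d) where

  private
    i+i<d : i + suc i < d
    i+i<d = 2+2i≤d
    i≤d : i ≤ d
    i≤d = ℕ.≤-trans (ℕ.m≤m+n i (suc i)) (ℕ.<⇒≤ i+i<d)
    ε-i : levelEccentricity d i ≡ d ∸ i
    ε-i = levelEccentricity-lower i (ℕ.≤-trans (ℕ.+-monoʳ-≤ i (ℕ.n≤1+n i)) (ℕ.<⇒≤ i+i<d))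
    ε-suc : levelEccentricity d (suc i) ≡ d ∸ suc i
    ε-suc = levelEccentricity-lower (suc i) 2+2i≤d

  -- Both levels lie in the lower half, where the eccentricity is the distance to level `d`; it
  -- drops by one.
  levelShare-suc : levelShare d i < levelShare d (suc i)
  levelShare-suc = share-mono-< (1≤levelEccentricity 1≤d (suc i))
    (subst₂ _<_ (sym ε-suc) (sym ε-i) (ℕ.∸-monoʳ-< (ℕ.n<1+n i) (ℕ.≤-trans (ℕ.m≤m+n (suc i) (suc i)) 2+2i≤d)))
    (levelEccentricity≤d i≤d)

  -- Level `2 + i`, that is `3 + j`, may lie beyond the middle, so both of its end distances are
  -- compared with `d ∸ j`. This bounds the share of a lost neighbour by that of a gained one.
  levelShare-pred : ∀ {j} → suc j ≡ i → levelShare d j ≤ levelShare d (2 + i)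
  levelShare-pred {j} refl = share-mono (1≤levelEccentricity 1≤d (3 + j))
    (ℕ.≤-trans (ℕ.⊔-lub (ℕ.m+n≤o⇒m≤o∸n (3 + j) 3+2j≤d) (ℕ.∸-monoʳ-≤ d (ℕ.m≤n+m j 3)))
               (ℕ.m≤n⊔m j (d ∸ j)))
    where
    3+2j≤d : 3 + j + j ≤ d
    3+2j≤d = ℕ.≤-trans (ℕ.≤-trans (s≤s (s≤s (s≤s (ℕ.+-monoʳ-≤ j (ℕ.n≤1+n j)))))
      (ℕ.≤-reflexive (cong (2 +_) (sym (ℕ.+-suc j (suc j)))))) 2+2i≤d

  -- What two distinct vertices on levels `a` and `b` contribute to the index, counted from both
  -- sides, as in the last sum of `sum-pairs-split`.
  pairShare : ℕ → ℕ → ℕ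
  pairShare a b = ⟦ near? a b ⟧ * levelShare d a + ⟦ near? b a ⟧ * levelShare d b

  private
    -- The worth of a gained edge, between levels `suc i` and `2 + i`. It also bounds the worth of a
    -- lost edge, between level `i` and the level below, so gains and losses can be compared by
    -- counting vertices.
    C = levelShare d (suc i) + levelShare d (2 + i)

  pairShare-near : ∀ a b → Near a b → pairShare a b ≡ levelShare d a + levelShare d b
  pairShare-near a b near = cong₂ _+_
    (trans (cong (_* _) (⟦⟧-true (near? a b) near)) (ℕ.*-identityˡ _))
    (trans (cong (_* _) (⟦⟧-true (near? b a) (near-sym near))) (ℕ.*-identityˡ _))

  pairShare-far : ∀ a b → ¬ Near a b → pairShare a b ≡ 0
  pairShare-far a b far = cong₂ _+_
    (cong (_* levelShare d a) (⟦⟧-false (near? a b) far))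
    (cong (_* levelShare d b) (⟦⟧-false (near? b a) (far ∘ near-sym)))

  -- Gain and loss stand on opposite sides to avoid subtraction. The level below is expressed by
  -- `suc b ≡ i`, not `b ≡ i ∸ 1`, so that there is none for `i ≡ 0`.
  pairShare-step : ∀ b → pairShare i b + ⟦ b ℕ.≟ 2 + i ⟧ * C ≤ pairShare (suc i) b + ⟦ suc b ℕ.≟ i ⟧ * C
  pairShare-step b with b ℕ.≟ 2 + i | suc b ℕ.≟ i
  ... | yes refl | no _ = subst₂ _≤_
    (sym (cong₂ _+_ (pairShare-far i (2 + i) λ (_ , ≤) → ℕ.1+n≰n ≤) (ℕ.*-identityˡ C)))
    (sym (trans (ℕ.+-identityʳ _) (pairShare-near (suc i) (2 + i) near-suc))) ℕ.≤-refl
  ... | yes refl | yes ()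
  ... | no _ | yes refl = subst₂ _≤_
    (sym (trans (ℕ.+-identityʳ _) (pairShare-near i b (near-sym near-suc))))
    (sym (cong₂ _+_ (pairShare-far (suc i) b λ (≤ , _) → ℕ.1+n≰n ≤) (ℕ.*-identityˡ C)))
    (ℕ.+-mono-≤ (ℕ.<⇒≤ levelShare-suc) (levelShare-pred refl))
  ... | no _ | no 1+b≢i = other (near? i b)
    where
    other : Dec (Near i b) → pairShare i b + 0 ≤ pairShare (suc i) b + 0
    other (no far) = subst (_≤ pairShare (suc i) b + 0) (sym (trans (ℕ.+-identityʳ _) (pairShare-far i b far))) z≤n
    other (yes near@(i≤1+b , b≤1+i)) = subst₂ _≤_
      (sym (trans (ℕ.+-identityʳ _) (pairShare-near i b near)))
      (sym (trans (ℕ.+-identityʳ _) (pairShare-near (suc i) b (i<1+b , ℕ.m≤n⇒m≤1+n b≤1+i))))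
      (ℕ.+-monoˡ-≤ (levelShare d b) (ℕ.<⇒≤ levelShare-suc))
      where i<1+b = ℕ.≤∧≢⇒< i≤1+b (1+b≢i ∘ sym)

  -- Vertices on levels `i` and `suc i` are adjacent before and after the move, so the larger share
  -- of the moved vertex is a strict gain.
  pairShare-step-< : pairShare i (suc i) + ⟦ suc i ℕ.≟ 2 + i ⟧ * C <
                     pairShare (suc i) (suc i) + ⟦ 2 + i ℕ.≟ i ⟧ * C
  pairShare-step-< = begin-strict
    pairShare i (suc i) + ⟦ suc i ℕ.≟ 2 + i ⟧ * C
      ≡⟨ cong₂ (λ p q → p + q * C) (pairShare-near i (suc i) near-suc) (⟦⟧-false (suc i ℕ.≟ 2 + i) (ℕ.1+n≢n ∘ sym)) ⟩
    levelShare d i + levelShare d (suc i) + 0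
      ≡⟨ ℕ.+-identityʳ _ ⟩
    levelShare d i + levelShare d (suc i)
      <⟨ ℕ.+-monoˡ-< (levelShare d (suc i)) levelShare-suc ⟩
    levelShare d (suc i) + levelShare d (suc i)
      ≡⟨ pairShare-near (suc i) (suc i) near-refl ⟨
    pairShare (suc i) (suc i)
      ≤⟨ ℕ.m≤m+n _ _ ⟩
    pairShare (suc i) (suc i) + ⟦ 2 + i ℕ.≟ i ⟧ * C ∎
    where open ℕ.≤-Reasoning

  module _ (ℓ : Fin n → ℕ) (x : Fin n) (ℓx≡i : ℓ x ≡ i) where

    private
      ℓ′ = updateAt ℓ x suc
      e = λ u → ⟦ ¬? (u Fin.≟ x) ⟧
      base = λ (ℓ : Fin n → ℕ) → sum λ v → sum λ u →
        ⟦ ¬? (v Fin.≟ u) ⟧ * (e v * e u * (⟦ near? (ℓ v) (ℓ u) ⟧ * levelShare d (ℓ v)))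

      away : ∀ {u} → u ≢ x → ℓ′ u ≡ ℓ u
      away {u} u≢x = updateAt-minimal u x ℓ u≢x

      base-cong : base ℓ′ ≡ base ℓ
      base-cong = sum-cong-≗ λ v → sum-cong-≗ λ u → cong (⟦ ¬? (v Fin.≟ u) ⟧ *_) (eq v u)
        where
        eq : ∀ v u → e v * e u * (⟦ near? (ℓ′ v) (ℓ′ u) ⟧ * levelShare d (ℓ′ v)) ≡
                     e v * e u * (⟦ near? (ℓ v) (ℓ u) ⟧ * levelShare d (ℓ v))
        eq v u with v Fin.≟ x | u Fin.≟ x
        ... | yes _  | _      = refl
        ... | no _   | yes _  = refl
        ... | no v≢x | no u≢x = cong₂ (λ a b → 1 * (⟦ near? a b ⟧ * levelShare d a)) (away v≢x) (away u≢x)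

      index-ℓ : levelIndex d ℓ ≡ base ℓ + sum (λ u → e u * pairShare i (ℓ u))
      index-ℓ = trans (sum-pairs-split x (λ v u → ⟦ near? (ℓ v) (ℓ u) ⟧ * levelShare d (ℓ v)))
        (cong (λ a → base ℓ + sum (λ u → e u * pairShare a (ℓ u))) ℓx≡i)

      index-ℓ′ : levelIndex d ℓ′ ≡ base ℓ + sum (λ u → e u * pairShare (suc i) (ℓ u))
      index-ℓ′ = trans (sum-pairs-split x (λ v u → ⟦ near? (ℓ′ v) (ℓ′ u) ⟧ * levelShare d (ℓ′ v)))
        (cong₂ _+_ base-cong (sum-cong-≗ eq))
        where
        eq : ∀ u → e u * pairShare (ℓ′ x) (ℓ′ u) ≡ e u * pairShare (suc i) (ℓ u)
        eq u with u Fin.≟ x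
        ... | yes _  = refl
        ... | no u≢x = cong₂ (λ a b → 1 * pairShare a b) (trans (updateAt-updates x ℓ) (cong suc ℓx≡i)) (away u≢x)

      gain loss : Fin n → ℕ
      gain u = ⟦ ℓ u ℕ.≟ 2 + i ⟧ * C
      loss u = ⟦ suc (ℓ u) ℕ.≟ i ⟧ * C

      step : ∀ u → e u * pairShare i (ℓ u) + gain u ≤ e u * pairShare (suc i) (ℓ u) + loss u
      step u with u Fin.≟ x
      ... | yes refl = subst (_≤ loss x)
        (sym (cong (_* C) (⟦⟧-false (ℓ x ℕ.≟ 2 + i) λ eq → ℕ.m≢1+n+m i (trans (sym ℓx≡i) eq)))) z≤n
      ... | no _     = subst₂ _≤_
        (cong (_+ gain u) (sym (ℕ.*-identityˡ _))) (cong (_+ loss u) (sym (ℕ.*-identityˡ _))) (pairShare-step (ℓ u))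

    -- The neighbours one level below are lost and those two levels above are
    -- gained; every other neighbour stays, with a larger share for x itself.
    levelIndex-move : ∀ {y} → ℓ y ≡ suc i → sum (λ u → ⟦ suc (ℓ u) ℕ.≟ i ⟧) ≤ levelSize ℓ (2 + i) →
      levelIndex d ℓ < levelIndex d ℓ′
    levelIndex-move {y} ℓy≡ lost≤gained = subst₂ _<_ (sym index-ℓ) (sym index-ℓ′)
      (ℕ.+-monoʳ-< (base ℓ) (ℕ.+-cancelʳ-< (sum gain) _ _ (begin-strict
        sum (λ u → e u * pairShare i (ℓ u)) + sum gain
          ≡⟨ ∑-distrib-+ (λ u → e u * pairShare i (ℓ u)) gain ⟨
        sum (λ u → e u * pairShare i (ℓ u) + gain u)
          <⟨ sum-mono-< step y step-y ⟩
        sum (λ u → e u * pairShare (suc i) (ℓ u) + loss u)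
          ≡⟨ ∑-distrib-+ (λ u → e u * pairShare (suc i) (ℓ u)) loss ⟩
        sum (λ u → e u * pairShare (suc i) (ℓ u)) + sum loss
          ≤⟨ ℕ.+-monoʳ-≤ (sum (λ u → e u * pairShare (suc i) (ℓ u))) loss≤gain ⟩
        sum (λ u → e u * pairShare (suc i) (ℓ u)) + sum gain ∎)))
      where
      open ℕ.≤-Reasoning
      loss≤gain : sum loss ≤ sum gain
      loss≤gain = subst₂ _≤_
        (*-distribʳ-sum C (λ u → ⟦ suc (ℓ u) ℕ.≟ i ⟧)) (*-distribʳ-sum C (λ u → ⟦ ℓ u ℕ.≟ 2 + i ⟧)) (ℕ.*-monoˡ-≤ C lost≤gained)
      y≢x : y ≢ x
      y≢x refl = ℕ.1+n≢n (trans (sym ℓy≡) ℓx≡i)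
      step-y : e y * pairShare i (ℓ y) + gain y < e y * pairShare (suc i) (ℓ y) + loss y
      step-y = subst (λ b → b * pairShare i (ℓ y) + gain y < b * pairShare (suc i) (ℓ y) + loss y)
        (sym (⟦⟧-true (¬? (y Fin.≟ x)) y≢x))
        (subst₂ _<_ (cong (_+ gain y) (sym (ℕ.*-identityˡ _))) (cong (_+ loss y) (sym (ℕ.*-identityˡ _)))
          (subst (λ b → pairShare i b + ⟦ b ℕ.≟ 2 + i ⟧ * C < pairShare (suc i) b + ⟦ suc b ℕ.≟ i ⟧ * C)
            (sym ℓy≡) pairShare-step-<))

module _ {k d : ℕ} {ℓ : Fin n → ℕ} (L : Levelling k d ℓ) where

  move-levelling : ∀ x → ℓ x < d → least k d (ℓ x) < levelSize ℓ (ℓ x) → Levelling k d (updateAt ℓ x suc)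
  move-levelling x ℓx<d surplus = record { bounded = bounded′ ; large = large′ }
    where
    ℓ′ = updateAt ℓ x suc

    bounded′ : ∀ v → ℓ′ v ≤ d
    bounded′ v with v Fin.≟ x
    ... | yes refl = subst (_≤ d) (sym (updateAt-updates x ℓ)) ℓx<d
    ... | no v≢x   = subst (_≤ d) (sym (updateAt-minimal v x ℓ v≢x)) (bounded L v)

    -- A lower bound for the new sizes suffices: only the old level of `x` shrinks, by one, and the
    -- growth of the next level is discarded.
    term≤ : ∀ j v → ⟦ ℓ v ℕ.≟ j ⟧ ≤ ⟦ ℓ′ v ℕ.≟ j ⟧ + ⟦ v Fin.≟ x ⟧ * ⟦ ℓ x ℕ.≟ j ⟧
    term≤ j v with v Fin.≟ x
    ... | yes refl = ℕ.≤-trans (ℕ.≤-reflexive (sym (ℕ.*-identityˡ _))) (ℕ.m≤n+m _ ⟦ ℓ′ v ℕ.≟ j ⟧)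
    ... | no v≢x   = ℕ.≤-reflexive (trans (cong (λ a → ⟦ a ℕ.≟ j ⟧) (sym (updateAt-minimal v x ℓ v≢x)))
                                          (sym (ℕ.+-identityʳ _)))

    size≤ : ∀ j → levelSize ℓ j ≤ levelSize ℓ′ j + ⟦ ℓ x ℕ.≟ j ⟧
    size≤ j = ℕ.≤-trans (sum-mono (term≤ j)) (ℕ.≤-reflexive (trans
      (∑-distrib-+ (λ v → ⟦ ℓ′ v ℕ.≟ j ⟧) (λ v → ⟦ v Fin.≟ x ⟧ * ⟦ ℓ x ℕ.≟ j ⟧))
      (cong (levelSize ℓ′ j +_) (sum-select x λ _ → ⟦ ℓ x ℕ.≟ j ⟧))))

    large′ : ∀ {j} → j ≤ d → least k d j ≤ levelSize ℓ′ j
    large′ {j} j≤d = enough (ℓ x ℕ.≟ j) (size≤ j)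
      where
      enough : (ℓx≡j? : Dec (ℓ x ≡ j)) → levelSize ℓ j ≤ levelSize ℓ′ j + ⟦ ℓx≡j? ⟧ → least k d j ≤ levelSize ℓ′ j
      enough (yes refl) size≤ = ℕ.≤-pred (ℕ.≤-trans surplus (ℕ.≤-trans size≤ (ℕ.≤-reflexive (ℕ.+-comm _ 1))))
      enough (no _)     size≤ = ℕ.≤-trans (large L j≤d) (ℕ.≤-trans size≤ (ℕ.≤-reflexive (ℕ.+-identityʳ _)))

IndexMaximal : (k d : ℕ) → (Fin n → ℕ) → Set
IndexMaximal {n} k d ℓ = ∀ (ℓ′ : Fin n → ℕ) → Levelling k d ℓ′ → levelIndex d ℓ′ ≤ levelIndex d ℓ

module _ {k d : ℕ} (1≤k : 1 ≤ k) (3≤d : 3 ≤ d) where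

  -- The choice of an outermost surplus level becomes an induction on `i`: the least size of the
  -- level below is what bounds the lost neighbours.
  lowerLevelSize : {ℓ : Fin n → ℕ} → Levelling k d ℓ → IndexMaximal k d ℓ →
    ∀ i → suc i + suc i ≤ d → levelSize ℓ i ≡ least k d i
  lowerLevelSize {n} {ℓ} L max = size
    where
    no-surplus : ∀ i → suc i + suc i ≤ d → sum (λ u → ⟦ suc (ℓ u) ℕ.≟ i ⟧) ≤ levelSize ℓ (2 + i) →
      levelSize ℓ i ≡ least k d i
    no-surplus i 2+2i≤d lost≤gained = ℕ.≤-antisym (ℕ.≮⇒≥ surplus⇒⊥) (large L (ℕ.<⇒≤ 1+i≤d))
      where
      1+i≤d : suc i ≤ d
      1+i≤d = ℕ.≤-trans (ℕ.m≤m+n (suc i) (suc i)) 2+2i≤d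
      surplus⇒⊥ : ¬ (least k d i < levelSize ℓ i)
      surplus⇒⊥ surplus
        with x , refl ← levelSize>0⇒inhabited ℓ i (ℕ.≤-trans (s≤s z≤n) surplus)
           | y , ℓy≡ ← inhabited 1≤k L 1+i≤d
        = ℕ.<⇒≱ (levelIndex-move (ℕ.≤-trans (s≤s z≤n) 3≤d) 2+2i≤d ℓ x refl ℓy≡ lost≤gained)
                (max _ (move-levelling L x 1+i≤d surplus))

    size : ∀ i → suc i + suc i ≤ d → levelSize ℓ i ≡ least k d i
    -- Nothing lies below level 0, so a vertex moved from there loses no neighbour.
    size zero    2≤d    = no-surplus 0 2≤d (subst (_≤ levelSize ℓ 2) (sym (sum-zero {n} λ v → refl)) z≤n)
    size (suc j) 4+2j≤d = no-surplus (suc j) 4+2j≤d (begin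
      sum (λ u → ⟦ suc (ℓ u) ℕ.≟ suc j ⟧)
        ≡⟨ sum-cong-≗ (λ u → ⟦⟧-cong (suc (ℓ u) ℕ.≟ suc j) (ℓ u ℕ.≟ j) ℕ.suc-injective (cong suc)) ⟩
      levelSize ℓ j
        ≡⟨ size j (ℕ.≤-trans (ℕ.+-mono-≤ (ℕ.n≤1+n (suc j)) (ℕ.n≤1+n (suc j))) 4+2j≤d) ⟩
      least k d j
        ≤⟨ least≤ d j 1≤k ⟩
      k
        ≤⟨ k≤levelSize 1≤k L (s≤s z≤n) (ℕ.≤-trans (ℕ.≤-reflexive (ℕ.+-comm 2 (2 + j)))
             (ℕ.≤-trans (ℕ.+-monoʳ-≤ (2 + j) (s≤s (s≤s z≤n))) 4+2j≤d)) ⟩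
      levelSize ℓ (3 + j) ∎)
      where open ℕ.≤-Reasoning

-- Reversing the order of the levels

near-mirror : ∀ d {a b} → Near a b → Near (d ∸ a) (d ∸ b)
near-mirror d (a≤1+b , b≤1+a) = half b≤1+a , half a≤1+b
  where
  half : ∀ {a b} → b ≤ suc a → d ∸ a ≤ suc (d ∸ b)
  half {a} {b} b≤1+a = ℕ.m≤n+o⇒m∸n≤o d a (ℕ.≤-trans (ℕ.m≤n+m∸n d b)
    (ℕ.≤-trans (ℕ.+-monoˡ-≤ (d ∸ b) b≤1+a) (ℕ.≤-reflexive (sym (ℕ.+-suc a (d ∸ b))))))

least-mirror : ∀ k {d i} → i ≤ d → least k d (d ∸ i) ≡ least k d i
least-mirror k {d} {zero}  _ = least-end k d
least-mirror k {d} {suc i} i<d with suc i ℕ.≟ d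
... | yes refl = cong (least k (suc i)) (ℕ.n∸n≡0 i)
... | no i≢d   = least-interior k (ℕ.m<n⇒0<n∸m (ℕ.≤∧≢⇒< i<d i≢d)) (ℕ.∸-monoʳ-< {d} (s≤s z≤n) i<d)

module _ {k d : ℕ} {ℓ : Fin n → ℕ} (L : Levelling k d ℓ) where

  private
    ℓ′ : Fin n → ℕ
    ℓ′ v = d ∸ ℓ v

  levelSize-mirror : ∀ {i} → i ≤ d → levelSize ℓ′ i ≡ levelSize ℓ (d ∸ i)
  levelSize-mirror {i} i≤d = sum-cong-≗ λ v → ⟦⟧-cong (d ∸ ℓ v ℕ.≟ i) (ℓ v ℕ.≟ d ∸ i)
    (λ eq → trans (sym (ℕ.m∸[m∸n]≡n (bounded L v))) (cong (d ∸_) eq))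
    (λ eq → trans (cong (d ∸_) eq) (ℕ.m∸[m∸n]≡n i≤d))

  levelling-mirror : Levelling k d ℓ′
  levelling-mirror .bounded v = ℕ.m∸n≤m d (ℓ v)
  levelling-mirror .large {i} i≤d = subst₂ _≤_ (least-mirror k i≤d) (sym (levelSize-mirror i≤d))
    (large L (ℕ.m∸n≤m d i))

  -- Reversal preserves nearness and merely swaps the two arguments of the maximum in
  -- `levelEccentricity`.
  levelIndex-mirror : levelIndex d ℓ′ ≡ levelIndex d ℓ
  levelIndex-mirror = sum-cong-≗ λ v → sum-cong-≗ λ u → cong (⟦ ¬? (v Fin.≟ u) ⟧ *_) (cong₂ _*_
    (⟦⟧-cong (near? (ℓ′ v) (ℓ′ u)) (near? (ℓ v) (ℓ u))
      (subst₂ Near (ℕ.m∸[m∸n]≡n (bounded L v)) (ℕ.m∸[m∸n]≡n (bounded L u)) ∘ near-mirror d)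
      (near-mirror d))
    (cong (share d) (trans (cong ((d ∸ ℓ v) ⊔_) (ℕ.m∸[m∸n]≡n (bounded L v))) (ℕ.⊔-comm (d ∸ ℓ v) (ℓ v)))))

upperLevelSize : ∀ {k d} → 1 ≤ k → 3 ≤ d → {ℓ : Fin n → ℕ} → Levelling k d ℓ → IndexMaximal k d ℓ →
  ∀ i → suc i + suc i ≤ d → levelSize ℓ (d ∸ i) ≡ least k d i
upperLevelSize {d = d} 1≤k 3≤d L max i 2+2i≤d = trans
  (sym (levelSize-mirror L (ℕ.≤-trans (ℕ.n≤1+n i) (ℕ.≤-trans (ℕ.m≤m+n (suc i) (suc i)) 2+2i≤d))))
  (lowerLevelSize 1≤k 3≤d (levelling-mirror L)
    (λ ℓ′ L′ → ℕ.≤-trans (max ℓ′ L′) (ℕ.≤-reflexive (sym (levelIndex-mirror L)))) i 2+2i≤d)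

-- Isomorphism with a sequential join

-- `Fin (⟦ P? ⟧ + m)` is one recursion step of a fibre: a slot for vertex `zero` if it belongs to
-- the fibre, followed by the `m` slots of the later vertices.
first : {P : Set} {m : ℕ} (P? : Dec P) → P → Fin (⟦ P? ⟧ + m)
first (yes _) _ = zero
first (no ¬p) p = contradiction p ¬p

module _ {P A : Set} {m : ℕ} where

  select : (P? : Dec P) → A → (Fin m → A) → Fin (⟦ P? ⟧ + m) → A
  select (yes _) a g zero    = a
  select (yes _) a g (suc i) = g i
  select (no _)  a g i       = g i

  select-first : ∀ (P? : Dec P) p a g → select P? a g (first P? p) ≡ a
  select-first (yes _) p a g = refl
  select-first (no ¬p) p a g = contradiction p ¬p

  select-↑ʳ : ∀ (P? : Dec P) a g i → select P? a g (⟦ P? ⟧ ↑ʳ i) ≡ g i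
  select-↑ʳ (yes _) a g i = refl
  select-↑ʳ (no _)  a g i = refl

  select-elim : (Q : A → Set) → ∀ (P? : Dec P) {a g} → (P → Q a) → (∀ i → Q (g i)) →
    ∀ i → Q (select P? a g i)
  select-elim Q (yes p) qa qg zero    = qa p
  select-elim Q (yes _) qa qg (suc i) = qg i
  select-elim Q (no _)  qa qg i       = qg i

  select-injective : ∀ (P? : Dec P) {a g} → (∀ i → a ≢ g i) → (∀ {i j} → g i ≡ g j → i ≡ j) →
    ∀ {i j} → select P? a g i ≡ select P? a g j → i ≡ j
  select-injective (yes _) a∉g g-inj {zero}  {zero}  eq = refl
  select-injective (yes _) a∉g g-inj {zero}  {suc j} eq = contradiction eq (a∉g j)
  select-injective (yes _) a∉g g-inj {suc i} {zero}  eq = contradiction (sym eq) (a∉g i)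
  select-injective (yes _) a∉g g-inj {suc i} {suc j} eq = cong suc (g-inj eq)
  select-injective (no _)  a∉g g-inj eq = g-inj eq

module _ {t : ℕ} where

  fibreSize : (Fin n → Fin t) → Fin t → ℕ
  fibreSize f i = sum (λ v → ⟦ f v Fin.≟ i ⟧)

  rank : (f : Fin n → Fin t) → ∀ v → Fin (fibreSize f (f v))
  rank f zero    = first (f zero Fin.≟ f zero) refl
  rank f (suc v) = ⟦ f zero Fin.≟ f (suc v) ⟧ ↑ʳ rank (f ∘ suc) v

  unrank : (f : Fin n → Fin t) → ∀ i → Fin (fibreSize f i) → Fin n
  unrank {suc n} f i = select (f zero Fin.≟ i) zero (suc ∘ unrank (f ∘ suc) i)

  unrank-rank : (f : Fin n → Fin t) → ∀ v → unrank f (f v) (rank f v) ≡ v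
  unrank-rank f zero    = select-first (f zero Fin.≟ f zero) refl zero _
  unrank-rank f (suc v) = trans (select-↑ʳ (f zero Fin.≟ f (suc v)) zero _ (rank (f ∘ suc) v))
                                (cong suc (unrank-rank (f ∘ suc) v))

  unrank-fibre : (f : Fin n → Fin t) → ∀ i r → f (unrank f i r) ≡ i
  unrank-fibre {suc n} f i = select-elim (λ v → f v ≡ i) (f zero Fin.≟ i) id (unrank-fibre (f ∘ suc) i)

  unrank-injective : (f : Fin n → Fin t) → ∀ i {r s} → unrank f i r ≡ unrank f i s → r ≡ s
  unrank-injective {suc n} f i = select-injective (f zero Fin.≟ i) (λ _ ())
    (unrank-injective (f ∘ suc) i ∘ Fin.suc-injective)

  -- An equation of pairs, since `f (unrank f i r)` equals `i` only propositionally. It follows from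
  -- injectivity of `unrank` without a further recursion over the vertices.
  rank-unrank : (f : Fin n → Fin t) → ∀ i r →
    _≡_ {A = Σ (Fin t) (Fin ∘ fibreSize f)} (f (unrank f i r) , rank f (unrank f i r)) (i , r)
  rank-unrank f i r = from-unrank (unrank-fibre f i r) (unrank-rank f (unrank f i r))
    where
    from-unrank : ∀ {j s} → j ≡ i → unrank f j s ≡ unrank f i r → (j , s) ≡ (i , r)
    from-unrank refl eq = cong (i ,_) (unrank-injective f i eq)

  fibres↔ : (f : Fin n → Fin t) (size : Fin t → ℕ) → (∀ i → fibreSize f i ≡ size i) →
    Fin n ↔ Σ (Fin t) (Fin ∘ size)
  fibres↔ f size eq = mk↔ₛ′
    (λ v → f v , cast (eq (f v)) (rank f v))
    (λ (i , r) → unrank f i (cast (sym (eq i)) r))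
    (λ (i , r) → trans (cong (λ (j , s) → j , cast (eq j) s) (rank-unrank f i (cast (sym (eq i)) r)))
                       (cong (i ,_) (Fin.cast-involutive (eq i) (sym (eq i)) r)))
    (λ v → trans (cong (unrank f (f v)) (Fin.cast-involutive (sym (eq (f v))) (eq (f v)) (rank f v)))
                 (unrank-rank f v))

cliqueJoin-adj⇔ : ∀ ms (p q : CliqueJoinVertex ms) →
  Adj (cliqueJoin ms) p q ⇔ (p ≢ q × Near (toℕ (proj₁ p)) (toℕ (proj₁ q)))
cliqueJoin-adj⇔ ms p q = mk⇔ (⇒ p q) (⇐ p q)
  where
  ⇒ : ∀ p q → Adj (cliqueJoin ms) p q → p ≢ q × Near (toℕ (proj₁ p)) (toℕ (proj₁ q))
  ⇒ p q pq = (λ { refl → loopless (cliqueJoin ms) pq }) , near pq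
    where
    near : ∀ {p q} → Adj (cliqueJoin ms) p q → Near (toℕ (proj₁ p)) (toℕ (proj₁ q))
    near (within _)   = near-refl
    near {i , _} (forward eq)  = subst (Near (toℕ i)) (sym eq) near-suc
    near {_} {j , _} (backward eq) = near-sym (subst (Near (toℕ j)) (sym eq) near-suc)
  ⇐ : ∀ p q → p ≢ q × Near (toℕ (proj₁ p)) (toℕ (proj₁ q)) → Adj (cliqueJoin ms) p q
  ⇐ (i , x) (j , y) (p≢q , i≤1+j , j≤1+i) with ℕ.<-cmp (toℕ i) (toℕ j)
  ... | tri< i<j _ _ = forward (ℕ.≤-antisym j≤1+i i<j)
  ... | tri> _ _ j<i = backward (ℕ.≤-antisym i≤1+j j<i)
  ... | tri≈ _ i≡j _ with refl ← Fin.toℕ-injective i≡j = within λ { refl → p≢q refl }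

levelGraph≅cliqueJoin : (ℓ : Fin n → ℕ) → ∀ d → (∀ v → ℓ v ≤ d) →
  levelGraph ℓ ≅ cliqueJoin (applyUpTo (levelSize ℓ) (suc d))
levelGraph≅cliqueJoin {n} ℓ d ℓ≤d = bijection , λ u v → mk⇔
  (λ (u≢v , near) → Equivalence.from (cliqueJoin-adj⇔ ms (to u) (to v))
    ((u≢v ∘ Injection.injective (↔⇒↣ bijection)) , subst₂ Near (sym (toℕ-f u)) (sym (toℕ-f v)) near))
  (λ uv → let ≢ , near = Equivalence.to (cliqueJoin-adj⇔ ms (to u) (to v)) uv in
    (≢ ∘ cong to) , subst₂ Near (toℕ-f u) (toℕ-f v) near)
  where
  ms = applyUpTo (levelSize ℓ) (suc d)

  ℓ<length : ∀ v → ℓ v < length ms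
  ℓ<length v = subst (ℓ v <_) (sym (length-applyUpTo (levelSize ℓ) (suc d))) (s≤s (ℓ≤d v))

  f : Fin n → Fin (length ms)
  f v = fromℕ< (ℓ<length v)

  toℕ-f : ∀ v → toℕ (f v) ≡ ℓ v
  toℕ-f v = Fin.toℕ-fromℕ< (ℓ<length v)

  bijection : Fin n ↔ CliqueJoinVertex ms
  bijection = fibres↔ f (lookup ms) λ i → trans
    (sum-cong-≗ λ v → ⟦⟧-cong (f v Fin.≟ i) (ℓ v ℕ.≟ toℕ i)
      (λ fv≡i → trans (sym (toℕ-f v)) (cong toℕ fv≡i))
      (λ ℓv≡i → Fin.toℕ-injective (trans (toℕ-f v) ℓv≡i)))
    (sym (lookup-applyUpTo (levelSize ℓ) (suc d) i))

  to = Inverse.to bijection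

-- The list of level sizes

applyUpTo-+ : {A : Set} (f : ℕ → A) → ∀ a b → applyUpTo f (a + b) ≡ applyUpTo f a ++ applyUpTo (f ∘ (a +_)) b
applyUpTo-+ f zero    b = refl
applyUpTo-+ f (suc a) b = cong (f 0 ∷_) (applyUpTo-+ (f ∘ suc) a b)

applyUpTo-cong : {A : Set} {f g : ℕ → A} → ∀ m → (∀ i → f i ≡ g i) → applyUpTo f m ≡ applyUpTo g m
applyUpTo-cong zero    f≗g = refl
applyUpTo-cong (suc m) f≗g = cong₂ _∷_ (f≗g 0) (applyUpTo-cong m (f≗g ∘ suc))

applyUpTo-const : {A : Set} {f : ℕ → A} {x : A} → ∀ a → (∀ {i} → i < a → f i ≡ x) → applyUpTo f a ≡ replicate a x
applyUpTo-const zero    f≡x = refl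
applyUpTo-const (suc a) f≡x = cong₂ _∷_ (f≡x (s≤s z≤n)) (applyUpTo-const a (f≡x ∘ s≤s))

sum-replicate : ∀ m k → ListAction.sum (replicate m k) ≡ m * k
sum-replicate zero    k = refl
sum-replicate (suc m) k = cong (k +_) (sum-replicate m k)

sum-applyUpTo-+ : ∀ f g m → ListAction.sum (applyUpTo (λ i → f i + g i) m) ≡
  ListAction.sum (applyUpTo f m) + ListAction.sum (applyUpTo g m)
sum-applyUpTo-+ f g zero    = refl
sum-applyUpTo-+ f g (suc m) = trans (cong (f 0 + g 0 +_) (sum-applyUpTo-+ (f ∘ suc) (g ∘ suc) m)) (interchange (f 0) (g 0) _ _)
  where
  interchange : ∀ a b c d → a + b + (c + d) ≡ a + c + (b + d)
  interchange = solve-∀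

sum-applyUpTo-select : ∀ {a m} → a < m → ListAction.sum (applyUpTo (λ i → ⟦ a ℕ.≟ i ⟧) m) ≡ 1
sum-applyUpTo-select {zero}  {suc m} _         = cong suc (trans (cong ListAction.sum (applyUpTo-const m λ _ → refl))
  (trans (sum-replicate m 0) (ℕ.*-zeroʳ m)))
sum-applyUpTo-select {suc a} {suc m} (s≤s a<m) = trans
  (cong ListAction.sum (applyUpTo-cong m λ i → ⟦⟧-cong (suc a ℕ.≟ suc i) (a ℕ.≟ i) ℕ.suc-injective (cong suc)))
  (sum-applyUpTo-select a<m)

-- Each vertex contributes 1 to exactly one of the levels up to `d`. This count determines the order
-- of a single middle level and the sum of two.
sum-levelSizes : (ℓ : Fin n → ℕ) → ∀ {d} → (∀ v → ℓ v ≤ d) → ListAction.sum (applyUpTo (levelSize ℓ) (suc d)) ≡ n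
sum-levelSizes {zero}  ℓ {d} ℓ≤d = trans (cong ListAction.sum (applyUpTo-const (suc d) λ _ → refl))
  (trans (sum-replicate (suc d) 0) (ℕ.*-zeroʳ (suc d)))
sum-levelSizes {suc n} ℓ {d} ℓ≤d = trans
  (sum-applyUpTo-+ (λ i → ⟦ ℓ zero ℕ.≟ i ⟧) (levelSize (ℓ ∘ suc)) (suc d))
  (cong₂ _+_ (sum-applyUpTo-select (s≤s (ℓ≤d zero))) (sum-levelSizes (ℓ ∘ suc) (ℓ≤d ∘ suc)))

-- The common shape of `evenOrders` and `oddOrders`, with the middle orders in `ms`.
sizeList : (k r : ℕ) → List ℕ → List ℕ
sizeList k r ms = 1 ∷ replicate r k ++ ms ++ replicate r k ++ 1 ∷ []

sum-sizeList : ∀ k r ms → ListAction.sum (sizeList k r ms) ≡ 2 + (r * k + r * k) + ListAction.sum ms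
sum-sizeList k r ms = begin
  suc (ListAction.sum (replicate r k ++ ms ++ replicate r k ++ 1 ∷ []))
    ≡⟨ cong suc (ListAction.sum-++ (replicate r k) _) ⟩
  suc (ListAction.sum (replicate r k) + ListAction.sum (ms ++ replicate r k ++ 1 ∷ []))
    ≡⟨ cong (λ a → suc (ListAction.sum (replicate r k) + a)) (ListAction.sum-++ ms _) ⟩
  suc (ListAction.sum (replicate r k) + (ListAction.sum ms + ListAction.sum (replicate r k ++ 1 ∷ [])))
    ≡⟨ cong (λ a → suc (ListAction.sum (replicate r k) + (ListAction.sum ms + a))) (ListAction.sum-++ (replicate r k) (1 ∷ [])) ⟩
  suc (ListAction.sum (replicate r k) + (ListAction.sum ms + (ListAction.sum (replicate r k) + 1)))
    ≡⟨ cong (λ a → suc (a + (ListAction.sum ms + (a + 1)))) (sum-replicate r k) ⟩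
  suc (r * k + (ListAction.sum ms + (r * k + 1)))
    ≡⟨ rearrange (r * k) (ListAction.sum ms) ⟩
  2 + (r * k + r * k) + ListAction.sum ms ∎
  where
  open ≡-Reasoning
  rearrange : ∀ a s → 1 + (a + (s + (a + 1))) ≡ 2 + (a + a) + s
  rearrange = solve-∀

-- Here `suc m` counts the middle levels: `m` is 0 for even and 1 for odd `d`. Levels 1 to `r` and
-- their mirror images satisfy the bound of `lowerLevelSize` and `upperLevelSize`, as do the ends.
levelSizes-maximal : ∀ {k d} → 1 ≤ k → 3 ≤ d → {ℓ : Fin n → ℕ} → Levelling k d ℓ → IndexMaximal k d ℓ →
  ∀ r m → d ≡ suc (r + (suc m + r)) →
  applyUpTo (levelSize ℓ) (suc d) ≡ sizeList k r (applyUpTo (λ i → levelSize ℓ (suc r + i)) (suc m))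
levelSizes-maximal {n} {k} {d} 1≤k 3≤d {ℓ} L max r m d≡ = begin
  applyUpTo c (suc d)
    ≡⟨ cong (applyUpTo c) (trans (cong suc d≡) (shift r m)) ⟩
  c 0 ∷ applyUpTo (c ∘ suc) (r + (suc m + (r + 1)))
    ≡⟨ cong₂ _∷_ (lowerLevelSize 1≤k 3≤d L max 0 (ℕ.≤-trans (ℕ.n≤1+n 2) 3≤d)) (applyUpTo-+ (c ∘ suc) r _) ⟩
  1 ∷ applyUpTo (c ∘ suc) r ++ applyUpTo (λ i → c (suc r + i)) (suc m + (r + 1))
    ≡⟨ cong₂ (λ a b → 1 ∷ a ++ b) (applyUpTo-const r lower) (applyUpTo-+ (λ i → c (suc r + i)) (suc m) _) ⟩
  1 ∷ replicate r k ++ applyUpTo (λ i → c (suc r + i)) (suc m) ++ applyUpTo (λ i → c (suc r + (suc m + i))) (r + 1)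
    ≡⟨ cong (λ a → 1 ∷ replicate r k ++ applyUpTo (λ i → c (suc r + i)) (suc m) ++ a)
         (trans (applyUpTo-+ (λ i → c (suc r + (suc m + i))) r 1)
                (cong₂ _++_ (applyUpTo-const r upper) (cong (_∷ []) top))) ⟩
  sizeList k r (applyUpTo (λ i → c (suc r + i)) (suc m)) ∎
  where
  open ≡-Reasoning
  c = levelSize ℓ

  shift : ∀ r m → 2 + (r + (1 + m + r)) ≡ 1 + (r + (1 + m + (r + 1)))
  shift = solve-∀

  half : ∀ {i} → i ≤ r → suc i + suc i ≤ d
  half {i} i≤r = ℕ.≤-trans (ℕ.+-mono-≤ (s≤s i≤r) (s≤s i≤r))
    (ℕ.≤-trans (ℕ.+-monoʳ-≤ (suc r) (s≤s (ℕ.m≤n+m r m))) (ℕ.≤-reflexive (sym d≡)))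

  interior : ∀ {i} → 0 < i → i ≤ r → least k d i ≡ k
  interior {i} 0<i i≤r = least-interior k 0<i (ℕ.≤-trans (ℕ.m≤m+n (suc i) (suc i)) (half i≤r))

  lower : ∀ {i} → i < r → c (suc i) ≡ k
  lower {i} i<r = trans (lowerLevelSize 1≤k 3≤d L max (suc i) (half i<r)) (interior (s≤s z≤n) i<r)

  -- Position `j` behind the middle block is the level `i` steps below the top; `j ≡ r` is level `d`
  -- itself.
  from-top : ∀ {i j} → i + j ≡ r → suc r + (suc m + j) ≡ d ∸ i
  from-top {i} {j} i+j≡r = trans (sym (ℕ.m+n∸m≡n i (suc r + (suc m + j)))) (cong (_∸ i)
    (trans (swap i r m j) (trans (cong (λ a → suc (r + (suc m + a))) i+j≡r) (sym d≡))))
    where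
    swap : ∀ i r m j → i + (1 + r + (1 + m + j)) ≡ 1 + (r + (1 + m + (i + j)))
    swap = solve-∀

  upper : ∀ {j} → j < r → c (suc r + (suc m + j)) ≡ k
  upper {j} j<r = trans (cong c (from-top (ℕ.m∸n+n≡m (ℕ.<⇒≤ j<r))))
    (trans (upperLevelSize 1≤k 3≤d L max (r ∸ j) (half (ℕ.m∸n≤m r j)))
           (interior (ℕ.m<n⇒0<n∸m j<r) (ℕ.m∸n≤m r j)))

  top : c (suc r + (suc m + (r + 0))) ≡ 1
  top = trans (cong c (from-top {0} (ℕ.+-identityʳ r)))
              (upperLevelSize 1≤k 3≤d L max 0 (ℕ.≤-trans (ℕ.n≤1+n 2) 3≤d))

module _ {k d : ℕ} (1≤k : 1 ≤ k) (3≤d : 3 ≤ d) {ℓ : Fin n → ℕ} (L : Levelling k d ℓ) (L-max : IndexMaximal k d ℓ) where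

  private
    sizes = applyUpTo (levelSize ℓ) (suc d)

    sum-sizes : ∀ r ms → sizes ≡ sizeList k r ms → 2 + (r * k + r * k) + ListAction.sum ms ≡ n
    sum-sizes r ms eq = trans (sym (trans (cong ListAction.sum eq) (sum-sizeList k r ms))) (sum-levelSizes ℓ (bounded L))

  levelSizes-even : ∀ r → d ≡ suc r * 2 → sizes ≡ evenOrders n k d
  levelSizes-even r d≡ = trans shape (cong₂ (λ q m → sizeList k q (m ∷ [])) r≡ middle)
    where
    -- The `+ 0` keeps `c` literally equal to the entry produced by `applyUpTo` in
    -- `levelSizes-maximal`.
    c = levelSize ℓ (suc r + 0)

    shape : sizes ≡ sizeList k r (c ∷ [])
    shape = levelSizes-maximal 1≤k 3≤d L L-max r 0 (trans d≡ (double r))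
      where double : ∀ r → (1 + r) * 2 ≡ 1 + (r + (1 + r))
            double = solve-∀

    r≡ : r ≡ (d ∸ 2) / 2
    r≡ = trans (sym (m*n/n≡m r 2)) (cong (λ d → (d ∸ 2) / 2) (sym d≡))

    -- In particular `k * d + 2 ≤ n + 2 * k`, so the subtraction in `evenOrders` does not truncate.
    balance : n + 2 * k ≡ c + (k * d + 2)
    balance = trans (cong (_+ 2 * k) (sym (sum-sizes r (c ∷ []) shape)))
      (trans (rearrange r k c) (cong (λ d → c + (k * d + 2)) (sym d≡)))
      where rearrange : ∀ r k c → 2 + (r * k + r * k) + (c + 0) + 2 * k ≡ c + (k * ((1 + r) * 2) + 2)
            rearrange = solve-∀

    middle : c ≡ n + 2 * k ∸ (k * d + 2)
    middle = sym (trans (cong (_∸ (k * d + 2)) balance) (ℕ.m+n∸n≡m c (k * d + 2)))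

  levelSizes-odd : ∀ r → d ≡ suc (suc r * 2) → ∃[ s ] ∃[ t ]
    k ∸ 1 ≤ s × k ∸ 1 ≤ t × s + t + k * d + 4 ≡ n + 3 * k × sizes ≡ oddOrders k d s t
  -- The two middle orders are to be written `s + 1` and `t + 1`; both are at least `k`, hence
  -- positive, so the predecessors do not truncate.
  levelSizes-odd r d≡ = a ∸ 1 , b ∸ 1 , ℕ.∸-monoˡ-≤ 1 k≤a , ℕ.∸-monoˡ-≤ 1 k≤b , balance
    , trans shape (cong₃-sizeList r≡ (predecessor k≤a) (predecessor k≤b))
    where
    a = levelSize ℓ (suc r + 0)
    b = levelSize ℓ (suc r + 1)

    interior : ∀ {j} → j ≤ 1 → suc r + j < d
    interior {j} j≤1 = subst (suc r + j <_) (sym d≡)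
      (s≤s (s≤s (ℕ.≤-trans (ℕ.+-mono-≤ (ℕ.m≤m*n r 2) j≤1) (ℕ.≤-reflexive (ℕ.+-comm (r * 2) 1)))))

    k≤a : k ≤ a
    k≤a = k≤levelSize 1≤k L (s≤s z≤n) (interior z≤n)

    k≤b : k ≤ b
    k≤b = k≤levelSize 1≤k L (s≤s z≤n) (interior ℕ.≤-refl)

    predecessor : ∀ {m} → k ≤ m → m ≡ m ∸ 1 + 1
    predecessor k≤m = sym (ℕ.m∸n+n≡m (ℕ.≤-trans 1≤k k≤m))

    shape : sizes ≡ sizeList k r (a ∷ b ∷ [])
    shape = levelSizes-maximal 1≤k 3≤d L L-max r 1 (trans d≡ (double r))
      where double : ∀ r → 1 + (1 + r) * 2 ≡ 1 + (r + (2 + r))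
            double = solve-∀

    r≡ : r ≡ (d ∸ 3) / 2
    r≡ = trans (sym (m*n/n≡m r 2)) (cong (λ d → (d ∸ 3) / 2) (sym d≡))

    cong₃-sizeList : ∀ {q x y} → r ≡ q → a ≡ x → b ≡ y → sizeList k r (a ∷ b ∷ []) ≡ sizeList k q (x ∷ y ∷ [])
    cong₃-sizeList refl refl refl = refl

    balance : a ∸ 1 + (b ∸ 1) + k * d + 4 ≡ n + 3 * k
    balance = trans (cong (λ d → a ∸ 1 + (b ∸ 1) + k * d + 4) d≡)
      (trans (rearrange r k (a ∸ 1) (b ∸ 1)) (cong (_+ 3 * k)
        (trans (cong₂ (λ a b → 2 + (r * k + r * k) + (a + (b + 0))) (sym (predecessor k≤a)) (sym (predecessor k≤b)))
               (sum-sizes r (a ∷ b ∷ []) shape))))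
      where rearrange : ∀ r k s t → s + t + k * (1 + (1 + r) * 2) + 4 ≡
                                    2 + (r * k + r * k) + ((s + 1) + ((t + 1) + 0)) + 3 * k
            rearrange = solve-∀

-- Maximal graphs

-- For every levelling `ℓ′`, `levelIndex d ℓ′ ≤ scaledIndex d G ≤ levelIndex d
-- ℓ`, which makes `ℓ` maximal. With `ℓ′` equal to `ℓ` the second inequality cannot be strict, so no
-- edge of `levelGraph ℓ` is missing in `G`.
maximal-levelling : ∀ {k n d} → 1 ≤ k → 3 ≤ d → (G : Graph (Fin n)) → 𝔾 k n d G →
  (∀ (G′ : Graph (Fin n)) → 𝔾 k n d G′ → ξᶜᵉ G′ ℚ.≤ ξᶜᵉ G) →
  ∃[ ℓ ] Levelling k d ℓ × IndexMaximal k d ℓ × (∀ u v → Adj G u v ⇔ Adj (levelGraph ℓ) u v)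
maximal-levelling {k} {n} {d} 1≤k 3≤d G G∈𝔾 G-max
  with ℓ , L , lip ← distance-levelling 1≤k 3≤d G G∈𝔾
  = ℓ , L
  , (λ ℓ′ L′ → ℕ.≤-trans (levelIndex≤ ℓ′ L′) (scaledIndex≤levelIndex 1≤k 3≤d L G lip))
  , λ u v → mk⇔ (λ uv → (λ { refl → loopless G uv }) , lip uv)
      λ uv → decidable-stable (adj? G u v) λ ¬uv →
        ℕ.<⇒≱ (scaledIndex<levelIndex 1≤k 3≤d L G lip uv ¬uv) (levelIndex≤ ℓ L)
  where
  Gε : EccentricitiesIn[1, d ] G
  Gε v with ℓ , L , lip ← distance-levelling 1≤k 3≤d G G∈𝔾
    = ℕ.≤-trans (1≤levelEccentricity (ℕ.≤-trans (s≤s z≤n) 3≤d) (ℓ v)) (levelEccentricity≤ 1≤k L G lip v)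
    , subst (eccentricity G v ≤_) (proj₂ (proj₂ G∈𝔾)) (eccentricity≤diameter G v)

  levelIndex≤ : ∀ (ℓ′ : Fin n → ℕ) → Levelling k d ℓ′ → levelIndex d ℓ′ ≤ scaledIndex d G
  levelIndex≤ ℓ′ L′ = decidable-stable (_ ℕ.≤? _) λ ≰ → levelGraph∈𝔾 1≤k 3≤d L′ λ ∈𝔾 →
    ≰ (subst (_≤ scaledIndex d G) (levelIndex-scaled 1≤k 3≤d L′)
        (scaledIndex-mono d (levelGraph ℓ′) G ℓ′ε Gε (G-max (levelGraph ℓ′) ∈𝔾)))
    where
    ℓ′ε : EccentricitiesIn[1, d ] (levelGraph ℓ′)
    ℓ′ε v = subst (λ e → 1 ≤ e × e ≤ d) (sym (levelGraph-eccentricity 1≤k 3≤d L′ v))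
      (1≤levelEccentricity (ℕ.≤-trans (s≤s z≤n) 3≤d) (ℓ′ v) , levelEccentricity≤d (bounded L′ v))

halve : ∀ d → ∃[ q ] (d ≡ q * 2 ⊎ d ≡ suc (q * 2))
halve zero = 0 , inj₁ refl
halve (suc d) with halve d
... | q , inj₁ d≡2q   = q , inj₂ (cong suc d≡2q)
... | q , inj₂ d≡1+2q = suc q , inj₁ (cong suc d≡1+2q)

module _ {k n d : ℕ} (1≤k : 1 ≤ k) (3≤d : 3 ≤ d) (G : Graph (Fin n)) {ℓ : Fin n → ℕ}
  (L : Levelling k d ℓ) (L-max : IndexMaximal k d ℓ) (adj⇔ : ∀ u v → Adj G u v ⇔ Adj (levelGraph ℓ) u v)
  where

  private
    G≅ : ∀ {ms} → applyUpTo (levelSize ℓ) (suc d) ≡ ms → G ≅ cliqueJoin ms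
    G≅ refl = proj₁ levels≅ , λ u v → mk⇔
      (Equivalence.to (proj₂ levels≅ u v) ∘ Equivalence.to (adj⇔ u v))
      (Equivalence.from (adj⇔ u v) ∘ Equivalence.from (proj₂ levels≅ u v))
      where levels≅ = levelGraph≅cliqueJoin ℓ d (bounded L)

  maximal-even : 2 ∣ d → G ≅ G⟨ n , k , d ⟩
  maximal-even (divides zero    d≡0) = contradiction (subst (3 ≤_) d≡0 3≤d) λ ()
  maximal-even (divides (suc r) d≡)  = G≅ (levelSizes-even 1≤k 3≤d L L-max r d≡)

  maximal-odd : ¬ (2 ∣ d) → ℋ n k d G
  maximal-odd ¬2∣d = by-parity (halve d)
    where
    by-parity : ∃[ q ] (d ≡ q * 2 ⊎ d ≡ suc (q * 2)) → ℋ n k d G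
    by-parity (q     , inj₁ d≡2q) = contradiction (divides q d≡2q) ¬2∣d
    by-parity (zero  , inj₂ d≡1)  = contradiction (subst (3 ≤_) d≡1 3≤d) λ { (s≤s ()) }
    by-parity (suc r , inj₂ d≡)   =
      let s , t , k≤s , k≤t , total , eq = levelSizes-odd 1≤k 3≤d L L-max r d≡
      in  s , t , k≤s , k≤t , total , G≅ eq

theorem2p1 : (k n d : ℕ) → 1 ≤ k → 3 ≤ d →
    (G : Graph (Fin n)) → 𝔾 k n d G →
    (∀ (G′ : Graph (Fin n)) → 𝔾 k n d G′ → ξᶜᵉ G′ ℚ.≤ ξᶜᵉ G) →
    (2 ∣ d → G ≅ G⟨ n , k , d ⟩) × (¬ (2 ∣ d) → ℋ n k d G)
theorem2p1 k n d 1≤k 3≤d G G∈𝔾 G-max =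
  let ℓ , L , L-max , adj⇔ = maximal-levelling 1≤k 3≤d G G∈𝔾 G-max
  in  maximal-even 1≤k 3≤d G L L-max adj⇔ , maximal-odd 1≤k 3≤d G L L-max adj⇔
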